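{- Let $a$ and $b$ be positive integers with $b \geqslant 3$, let $\ell = a + b - 1$, and let $\mathcal{F}_{a,b}$ denote the family of $a$-locally $b$-partite graphs. Then \[\delta_{\chi}(\mathcal{F}_{a,b}, \ell + 1) \leqslant 1 - \frac{1}{\ell + 1/7},\] and, in particular, every locally $b$-partite graph $G$ with $\delta(G) > (1 - 1/(b + 1/7)) \cdot |G|$ is $(b+1)$-colourable.
   Context: All graphs are finite and simple; $|G|$ denotes the number of vertices and $\delta(G)$ the minimum degree. A graph is $a$-locally $b$-partite if for every clique $K$ on $a$ vertices, the subgraph induced on the common neighbourhood of the vertices of $K$ is $b$-colourable; locally $b$-partite means $1$-locally $b$-partite (every vertex neighbourhood induces a $b$-colourable graph). For a family $\mathcal{F}$ of graphs and a positive integer $k$, $\delta_{\chi}(\mathcal{F},k) = \inf\{d : \text{every } G \in \mathcal{F} \text{ with } \delta(G) \geqslant d|G| \text{ satisfies } \chi(G) \leqslant k\}$. -}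

module Defs where

open import Data.Nat using (ℕ; zero; suc; _+_; _*_; _∸_)
open import Data.Fin using (Fin)
open import Data.Bool using (Bool; true; false; if_then_else_)
open import Data.List using (map; allFin)
open import Data.Nat.ListAction using (sum)
open import Data.Integer using (+_)
open import Data.Rational using (ℚ; _/_; _<_; _≤_; 1ℚ; _-_)
import Data.Rational as ℚ
open import Data.Product using (Σ; ∃; _×_)
open import Relation.Binary.PropositionalEquality using (_≡_; _≢_)

record Graph (n : ℕ) : Set where
  field
    adj    : Fin n → Fin n → Bool
    sym    : ∀ u v → adj u v ≡ adj v u
    irrefl : ∀ v → adj v v ≡ false
open Graph public

deg : ∀ {n} → Graph n → Fin n → ℕ
deg {n} G v = sum (map (λ w → if adj G v w then 1 else 0) (allFin n))

toℚ : ℕ → ℚ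
toℚ m = + m / 1

Colourable : ∀ {n} → Graph n → ℕ → Set
Colourable {n} G k =
  Σ (Fin n → Fin k) λ c → ∀ u v → adj G u v ≡ true → c u ≢ c v

IsClique : ∀ {n a} → Graph n → (Fin a → Fin n) → Set
IsClique G K = ∀ i j → i ≢ j → (K i ≢ K j) × (adj G (K i) (K j) ≡ true)

InCommonNbhd : ∀ {n a} → Graph n → (Fin a → Fin n) → Fin n → Set
InCommonNbhd G K w = ∀ i → adj G (K i) w ≡ true

CommonNbhdColourable : ∀ {n a} → Graph n → (Fin a → Fin n) → ℕ → Set
CommonNbhdColourable {n} G K b =
  Σ ((w : Fin n) → InCommonNbhd G K w → Fin b) λ c →
    ∀ u v (pu : InCommonNbhd G K u) (pv : InCommonNbhd G K v) →
      adj G u v ≡ true → c u pu ≢ c v pv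

LocallyPartite : ℕ → ℕ → ∀ {n} → Graph n → Set
LocallyPartite a b {n} G =
  (K : Fin a → Fin n) → IsClique G K → CommonNbhdColourable G K b

MinDegAtLeast : ∀ {n} → Graph n → ℚ → Set
MinDegAtLeast {n} G d = ∀ v → d ℚ.* toℚ n ≤ toℚ (deg G v)

MinDegAbove : ∀ {n} → Graph n → ℚ → Set
MinDegAbove {n} G d = ∀ v → d ℚ.* toℚ n < toℚ (deg G v)

Family : Set₁
Family = ∀ {n} → Graph n → Set

-- δ_χ(F, k) ≤ c.  Since the set {d : every G ∈ F with δ(G) ≥ d|G| has χ(G) ≤ k}
-- is upward closed, its infimum is ≤ c iff every (rational) d > c belongs to it.
δχ≤ : Family → ℕ → ℚ → Set
δχ≤ F k c = ∀ (d : ℚ) → c < d →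
  ∀ n (G : Graph n) → F G → MinDegAtLeast G d → Colourable G k

-- 1 - 1/(m + 1/7) = 1 - 7/(7m + 1)
threshold : ℕ → ℚ
threshold m = 1ℚ - (+ 7 / suc (7 * m))

{-# OPTIONS --safe #-}
module Submission where

-- Let D bound the number of non-neighbours of a vertex, so that the degree condition reads
-- (7ℓ + 1) D < 7 |G|.  Passing to N(v) lowers both ℓ and |G|/D by one, which reduces a-local
-- b-partiteness to the case a = 1.
--
-- For a locally b-partite U with b ≥ 3, let A be a largest independent set.  Counting
-- non-neighbours shows that A ∩ N(w) lies in one class of every b-colouring of N(w).  If w ∉ A and
-- that class contained some u ∉ A, then u has a neighbour y ∈ A, and a greedily chosen clique in
-- N(w) ∩ N(u) ∩ N(z), z ∈ A, with a vertex r ∈ N(y) would force u and z, hence u and y, to have the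
-- same colour in N(r).  So A ∩ N(w) is a whole class, U ∖ A is locally (b − 1)-partite, and one
-- inducts down to b = 3.
--
-- For b = 3 let A′ be a largest independent set of W = U ∖ A.  The same argument shows that, for
-- z ∈ A, the set A′ ∩ N(z) is a whole class of N(z); it needs A′ ∩ N(r) to lie in one class of
-- N(r) ∩ W, which follows by counting if 7|A| ≤ D + 7|A′|, while otherwise 7|A| > 6D and r can be
-- replaced by a vertex of A.  (This is where 1/7 enters.)  Hence W ∖ A′ induces a bipartite graph
-- in every N(x), x ∈ U.  A vertex of W ∖ A′ is adjacent to at most two vertices of a shortest odd
-- closed walk in W ∖ A′, so by counting some vertex of A ∪ A′ is adjacent to all of it, which is
-- absurd.  Thus W ∖ A′ is bipartite and U is 4-colourable.

open import Defs renaming (sym to adj-sym)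
open import Data.Bool using (Bool; true; false; T; _∧_; _∨_; _xor_; not; if_then_else_)
import Data.Bool.Properties as Bool
open import Data.Bool.Properties using (∧-zeroʳ; ∧-identityʳ; ∨-zeroʳ; T-∧)
open import Data.Empty using (⊥; ⊥-elim)
open import Data.Fin as Fin using (Fin; zero; suc; _≟_; punchOut)
open import Data.Fin.Properties using (suc-injective; all?; any?; pigeonhole; punchOut-injective)
open import Data.Fin.Subset using (Subset)
open import Data.Fin.Subset.Properties using (anySubset?)
import Data.Integer as ℤ
import Data.Integer.Properties as ℤ
open import Data.Integer.Tactic.RingSolver using (solve-∀)
open import Data.List using (List; []; _∷_; map; allFin; length; lookup; tabulate)
open import Data.List.Membership.Propositional using (find; lose) renaming (_∈_ to _∈ₗ_)
open import Data.List.Membership.Propositional.Properties using (∈-allFin; ∈-∃++; ∈-lookup)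
open import Data.List.Properties using (map-tabulate; length-tabulate; length-map)
open import Data.List.Relation.Binary.Permutation.Propositional using (_↭_; ↭-refl; ↭-sym; ↭-trans; prep; swap; ↭⇒↭ₛ)
open import Data.List.Relation.Binary.Permutation.Propositional.Properties using (shift; map⁺; ∈-resp-↭; ↭-length)
import Data.List.Relation.Binary.Permutation.Setoid.Properties as ↭ₛ
open import Data.List.Relation.Unary.All as All using (All; []; _∷_)
open import Data.List.Relation.Unary.AllPairs using (AllPairs; []; _∷_)
open import Data.List.Relation.Unary.Any as Any using (Any; here; there)
open import Data.List.Relation.Unary.Unique.Propositional using (Unique)
open import Data.List.Relation.Unary.Unique.Propositional.Properties using (allFin⁺)
open import Data.Nat using (ℕ; zero; suc; _+_; _*_; _∸_; _⊔_; pred; _≤_; _<_; z≤n; s≤s; _<?_; _≤?_; _≤ᵇ_)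
open import Data.Nat.Induction using (<-rec)
open import Data.Nat.ListAction using (sum)
open import Data.Nat.ListAction.Properties using (sum-↭)
open import Data.Nat.Properties hiding (_≟_; suc-injective)
open import Data.Product using (Σ; ∃; ∃₂; _×_; _,_; proj₁; proj₂)
import Data.Rational as ℚ
import Data.Rational.Properties as ℚ
import Data.Rational.Unnormalised as ℚᵘ
import Data.Rational.Unnormalised.Properties as ℚᵘ
open import Data.Rational.Unnormalised using (mkℚᵘ; _≃_)
open import Data.Sum using (_⊎_; inj₁; inj₂)
open import Data.Unit using (⊤)
open import Data.Vec as Vec using (Vec; []; _∷_)
open import Data.Vec.Properties using (lookup∘tabulate)
open import Function using (_∘_; id)
open import Function.Bundles using (Equivalence)
open import Relation.Binary.PropositionalEquality hiding ([_])
open import Relation.Nullary using (¬_; Dec; yes; no; does; contradiction)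
open import Relation.Nullary.Decidable using (_×-dec_; _→-dec_; ¬?; dec-true; ¬¬-excluded-middle)

-- Linear arithmetic

interchange : ∀ a b c d → (a + b) + (c + d) ≡ (a + c) + (b + d)
interchange a b c d = begin
  (a + b) + (c + d)  ≡⟨ +-assoc a b (c + d) ⟩
  a + (b + (c + d))  ≡⟨ cong (a +_) (trans (sym (+-assoc b c d)) (trans (cong (_+ d) (+-comm b c)) (+-assoc c b d))) ⟩
  a + (c + (b + d))  ≡⟨ +-assoc a c (b + d) ⟨
  (a + c) + (b + d)  ∎
  where open ≡-Reasoning

module LinearArithmetic where

  infixl 9 _⊠_
  infixl 8 _⊞_
  infix  7 _≼_ _≼?_
  infixr 6 _·_
  infix  3 _⊢_

  data Lin (k : ℕ) : Set where
    var : Fin k → Lin k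
    con : ℕ → Lin k
    _⊞_ : Lin k → Lin k → Lin k
    _⊠_ : ℕ → Lin k → Lin k

  record Ineq (k : ℕ) : Set where
    constructor ineq
    field
      weight  : ℕ  -- Farkas multiplier
      lhs rhs : Lin k
  open Ineq

  _≼_ : ∀ {k} → Lin k → Lin k → Ineq k
  e ≼ f = ineq 1 e f

  _·_ : ∀ {k} → ℕ → Ineq k → Ineq k
  m · ineq w e f = ineq (m * w) e f

  record Sequent (k : ℕ) : Set where
    constructor _⊢_
    field
      hyps : List (Ineq k)
      goal : Ineq k

  ⟪_⟫ : ∀ {k} → Lin k → Vec ℕ k → ℕ
  ⟪ var i ⟫ ρ = Vec.lookup ρ i
  ⟪ con m ⟫ ρ = m
  ⟪ e ⊞ f ⟫ ρ = ⟪ e ⟫ ρ + ⟪ f ⟫ ρ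
  ⟪ m ⊠ e ⟫ ρ = m * ⟪ e ⟫ ρ

  Holds : ∀ {k} → Vec ℕ k → Ineq k → Set
  Holds ρ (ineq _ e f) = ⟪ e ⟫ ρ ≤ ⟪ f ⟫ ρ

  -- The singleton clause lets hypotheses be supplied as a tuple without a trailing unit.
  AllHold : ∀ {k} → Vec ℕ k → List (Ineq k) → Set
  AllHold ρ []       = ⊤
  AllHold ρ (h ∷ []) = Holds ρ h
  AllHold ρ (h ∷ hs) = Holds ρ h × AllHold ρ hs

  total : ∀ {k} → List (Ineq k) → Ineq k
  total []       = con 0 ≼ con 0
  total (h ∷ hs) = weight h ⊠ lhs h ⊞ lhs (total hs) ≼ weight h ⊠ rhs h ⊞ rhs (total hs)

  total-holds : ∀ {k} (ρ : Vec ℕ k) hs → AllHold ρ hs → Holds ρ (total hs)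
  total-holds ρ []            _        = z≤n
  total-holds ρ (h ∷ [])      p        = +-mono-≤ (*-monoʳ-≤ (weight h) p) z≤n
  total-holds ρ (h ∷ g ∷ hs)  (p , ps) = +-mono-≤ (*-monoʳ-≤ (weight h) p) (total-holds ρ (g ∷ hs) ps)

  coeff : ∀ {k} → Lin k → Fin k → ℕ
  coeff (var zero)    zero    = 1
  coeff (var zero)    (suc j) = 0
  coeff (var (suc i)) zero    = 0
  coeff (var (suc i)) (suc j) = coeff (var i) j
  coeff (con m)       j       = 0
  coeff (e ⊞ f)       j       = coeff e j + coeff f j
  coeff (m ⊠ e)       j       = m * coeff e j

  const : ∀ {k} → Lin k → ℕ
  const (var i) = 0
  const (con m) = m
  const (e ⊞ f) = const e + const f
  const (m ⊠ e) = m * const e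

  dot : ∀ {k} → (Fin k → ℕ) → Vec ℕ k → ℕ
  dot f []      = 0
  dot f (x ∷ ρ) = f zero * x + dot (λ i → f (suc i)) ρ

  dot-zero : ∀ {k} (ρ : Vec ℕ k) → dot (λ _ → 0) ρ ≡ 0
  dot-zero []      = refl
  dot-zero (x ∷ ρ) = dot-zero ρ

  dot-+ : ∀ {k} (f g : Fin k → ℕ) ρ → dot (λ i → f i + g i) ρ ≡ dot f ρ + dot g ρ
  dot-+ f g []      = refl
  dot-+ f g (x ∷ ρ) rewrite dot-+ (λ i → f (suc i)) (λ i → g (suc i)) ρ | *-distribʳ-+ x (f zero) (g zero) =
    interchange (f zero * x) (g zero * x) _ _

  dot-* : ∀ {k} m (f : Fin k → ℕ) ρ → dot (λ i → m * f i) ρ ≡ m * dot f ρ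
  dot-* m f []      = sym (*-zeroʳ m)
  dot-* m f (x ∷ ρ) rewrite dot-* m (λ i → f (suc i)) ρ | *-assoc m (f zero) x = sym (*-distribˡ-+ m _ _)

  dot-var : ∀ {k} (i : Fin k) ρ → dot (coeff (var i)) ρ ≡ Vec.lookup ρ i
  dot-var zero    (x ∷ ρ) = trans (cong₂ _+_ (*-identityˡ x) (dot-zero ρ)) (+-identityʳ x)
  dot-var (suc i) (x ∷ ρ) = dot-var i ρ

  dot-mono : ∀ {k} {f g : Fin k → ℕ} ρ → (∀ i → f i ≤ g i) → dot f ρ ≤ dot g ρ
  dot-mono []      h = z≤n
  dot-mono (x ∷ ρ) h = +-mono-≤ (*-monoˡ-≤ x (h zero)) (dot-mono ρ (λ i → h (suc i)))

  normal : ∀ {k} (e : Lin k) ρ → ⟪ e ⟫ ρ ≡ const e + dot (coeff e) ρ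
  normal (var i) ρ = sym (dot-var i ρ)
  normal (con m) ρ = sym (trans (cong (m +_) (dot-zero ρ)) (+-identityʳ m))
  normal (e ⊞ f) ρ = begin
    ⟪ e ⟫ ρ + ⟪ f ⟫ ρ                                                  ≡⟨ cong₂ _+_ (normal e ρ) (normal f ρ) ⟩
    (const e + dot (coeff e) ρ) + (const f + dot (coeff f) ρ)          ≡⟨ interchange (const e) _ _ _ ⟩
    (const e + const f) + (dot (coeff e) ρ + dot (coeff f) ρ)          ≡⟨ cong (const e + const f +_) (dot-+ (coeff e) (coeff f) ρ) ⟨
    (const e + const f) + dot (coeff (e ⊞ f)) ρ                        ∎
    where open ≡-Reasoning
  normal (m ⊠ e) ρ = begin
    m * ⟪ e ⟫ ρ                            ≡⟨ cong (m *_) (normal e ρ) ⟩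
    m * (const e + dot (coeff e) ρ)        ≡⟨ *-distribˡ-+ m (const e) _ ⟩
    m * const e + m * dot (coeff e) ρ      ≡⟨ cong (m * const e +_) (dot-* m (coeff e) ρ) ⟨
    m * const e + dot (coeff (m ⊠ e)) ρ    ∎
    where open ≡-Reasoning

  all≤ : ∀ {k} → (Fin k → ℕ) → (Fin k → ℕ) → Bool
  all≤ {zero}  f g = true
  all≤ {suc k} f g = (f zero ≤ᵇ g zero) ∧ all≤ (λ i → f (suc i)) (λ i → g (suc i))

  all≤-sound : ∀ {k} (f g : Fin k → ℕ) → T (all≤ f g) → ∀ i → f i ≤ g i
  all≤-sound f g t zero    = ≤ᵇ⇒≤ _ _ (proj₁ (Equivalence.to T-∧ t))
  all≤-sound f g t (suc i) = all≤-sound _ _ (proj₂ (Equivalence.to (T-∧ {f zero ≤ᵇ g zero}) t)) i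

  _≼?_ : ∀ {k} → Lin k → Lin k → Bool
  e ≼? f = (const e ≤ᵇ const f) ∧ all≤ (coeff e) (coeff f)

  ≼?-sound : ∀ {k} (e f : Lin k) ρ → T (e ≼? f) → ⟪ e ⟫ ρ ≤ ⟪ f ⟫ ρ
  ≼?-sound e f ρ t = subst₂ _≤_ (sym (normal e ρ)) (sym (normal f ρ))
    (+-mono-≤ (≤ᵇ⇒≤ _ _ (proj₁ (Equivalence.to T-∧ t)))
      (dot-mono ρ (all≤-sound (coeff e) (coeff f) (proj₂ (Equivalence.to (T-∧ {const e ≤ᵇ const f}) t)))))

  vars : ∀ k → Vec (Lin k) k
  vars k = Vec.tabulate var

  -- The goal l ≤ r follows when the hypotheses add up to L ≤ R with l + R ≤ r + L coefficientwise.
  check : ∀ {k} → Sequent k → Bool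
  check (hs ⊢ ineq _ l r) = l ⊞ rhs (total hs) ≼? r ⊞ lhs (total hs)

  opaque
    -- Products such as `b * D` may serve as atoms, since `ρ` takes arbitrary naturals. Once `check`
    -- evaluates to true, the implicit argument is the unit and is inferred. Contradictions are
    -- derived as the goal `con 1 ≼ con 0`.
    linear : ∀ {k} (ρ : Vec ℕ k) (f : Vec (Lin k) k → Sequent k) →
      {T (check (f (vars k)))} →
      AllHold ρ (Sequent.hyps (f (vars k))) → Holds ρ (Sequent.goal (f (vars k)))
    linear {k} ρ f {t} hs with f (vars k)
    ... | Γ ⊢ ineq _ l r = +-cancelʳ-≤ (⟪ rhs (total Γ) ⟫ ρ) _ _
      (≤-trans (≼?-sound (l ⊞ rhs (total Γ)) (r ⊞ lhs (total Γ)) ρ t)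
        (+-monoʳ-≤ (⟪ r ⟫ ρ) (total-holds ρ Γ hs)))

open LinearArithmetic using (linear; con; _⊞_; _⊠_; _≼_; _·_; _⊢_)

-- Sums and cardinalities

∑ : ∀ {A : Set} → List A → (A → ℕ) → ℕ
∑ xs f = sum (map f xs)

∑-mono : ∀ {A : Set} (xs : List A) {f g : A → ℕ} → (∀ x → x ∈ₗ xs → f x ≤ g x) → ∑ xs f ≤ ∑ xs g
∑-mono []       h = z≤n
∑-mono (x ∷ xs) h = +-mono-≤ (h x (here refl)) (∑-mono xs (λ y y∈ → h y (there y∈)))

∑-cong : ∀ {A : Set} (xs : List A) {f g : A → ℕ} → (∀ x → f x ≡ g x) → ∑ xs f ≡ ∑ xs g
∑-cong []       h = refl
∑-cong (x ∷ xs) h = cong₂ _+_ (h x) (∑-cong xs h)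

∑-+ : ∀ {A : Set} (xs : List A) (f g : A → ℕ) → ∑ xs (λ x → f x + g x) ≡ ∑ xs f + ∑ xs g
∑-+ []       f g = refl
∑-+ (x ∷ xs) f g rewrite ∑-+ xs f g = interchange (f x) (g x) (∑ xs f) (∑ xs g)

∑-const : ∀ {A : Set} (xs : List A) k → ∑ xs (λ _ → k) ≡ length xs * k
∑-const []       k = refl
∑-const (x ∷ xs) k = cong (k +_) (∑-const xs k)

∑-* : ∀ {A : Set} (xs : List A) k (f : A → ℕ) → ∑ xs (λ x → k * f x) ≡ k * ∑ xs f
∑-* []       k f = sym (*-zeroʳ k)
∑-* (x ∷ xs) k f = trans (cong (k * f x +_) (∑-* xs k f)) (sym (*-distribˡ-+ k (f x) (∑ xs f)))

∑-swap : ∀ {A B : Set} (xs : List A) (ys : List B) (f : A → B → ℕ) →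
  ∑ xs (λ x → ∑ ys (f x)) ≡ ∑ ys (λ y → ∑ xs (λ x → f x y))
∑-swap []       ys f = sym (trans (∑-const ys 0) (*-zeroʳ (length ys)))
∑-swap (x ∷ xs) ys f =
  trans (cong (∑ ys (f x) +_) (∑-swap xs ys f)) (sym (∑-+ ys (f x) (λ y → ∑ xs (λ x → f x y))))

∑-↭ : ∀ {A : Set} {xs ys : List A} (f : A → ℕ) → xs ↭ ys → ∑ xs f ≡ ∑ ys f
∑-↭ f p = sum-↭ (map⁺ f p)

∑-positive : ∀ {A : Set} (xs : List A) (f : A → ℕ) → 0 < ∑ xs f → ∃ λ x → x ∈ₗ xs × 0 < f x
∑-positive (x ∷ xs) f h with f x in eq
... | suc k = x , here refl , subst (0 <_) (sym eq) (s≤s z≤n)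
... | zero with ∑-positive xs f h
...   | y , y∈ , p = y , there y∈ , p

∑-member : ∀ {A : Set} {xs : List A} (f : A → ℕ) {x} → x ∈ₗ xs → f x ≤ ∑ xs f
∑-member f (here refl)              = m≤m+n _ _
∑-member f (there {x = y} x∈)       = ≤-trans (∑-member f x∈) (m≤n+m _ (f y))

bring-to-front : ∀ {A : Set} {xs : List A} {x} → x ∈ₗ xs → ∃ λ ys → xs ↭ x ∷ ys
bring-to-front x∈ with ∈-∃++ x∈
... | as , bs , refl = _ , shift _ as bs

χ : Bool → ℕ
χ b = if b then 1 else 0

VSet : ℕ → Set
VSet n = Fin n → Bool

infix 4 _∈_ _⊆_
infixl 6 _∩_ _∪_ _∖_

record _∈_ {n : ℕ} (v : Fin n) (S : VSet n) : Set where
  constructor mem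
  field holds : S v ≡ true
open _∈_

_∈?_ : ∀ {n} (v : Fin n) (S : VSet n) → Dec (v ∈ S)
v ∈? S with S v in eq
... | true  = yes (mem eq)
... | false = no λ (mem p) → contradiction (trans (sym eq) p) λ ()

∉⇒false : ∀ {n} {v : Fin n} {S : VSet n} → ¬ v ∈ S → S v ≡ false
∉⇒false {v = v} {S} v∉S with S v in eq
... | true  = ⊥-elim (v∉S (mem eq))
... | false = refl

_⊆_ : ∀ {n} → VSet n → VSet n → Set
S ⊆ T = ∀ {v} → v ∈ S → v ∈ T

full : ∀ {n} → VSet n
full v = true

-- Opaque operations, so that sets can be inferred from membership proofs.
abstract
  ∅ : ∀ {n} → VSet n
  ∅ v = false

  _∩_ _∪_ _∖_ : ∀ {n} → VSet n → VSet n → VSet n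
  (S ∩ T) v = S v ∧ T v
  (S ∪ T) v = S v ∨ T v
  (S ∖ T) v = S v ∧ not (T v)

  ⟦_⟧ : ∀ {n} → Fin n → VSet n
  ⟦ u ⟧ v = does (v ≟ u)

  part : ∀ {n k} → VSet n → (Fin n → Fin k) → Fin k → VSet n
  part S c i v = S v ∧ does (c v ≟ i)

  ∣_∣ : ∀ {n} → VSet n → ℕ
  ∣_∣ {n} S = ∑ (allFin n) (χ ∘ S)

  -- Lets sums over vertices be matched with cardinalities where `∣_∣` does not unfold.
  card-def : ∀ {n} (S : VSet n) → ∣ S ∣ ≡ ∑ (allFin n) (χ ∘ S)
  card-def {n} S = refl {x = ∑ (allFin n) (χ ∘ S)}

module _ {n : ℕ} {S T : VSet n} {v : Fin n} where abstract

  ∩⁺ : v ∈ S → v ∈ T → v ∈ S ∩ T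
  ∩⁺ (mem p) (mem q) = mem (cong₂ _∧_ p q)

  ∩ˡ : v ∈ S ∩ T → v ∈ S
  ∩ˡ (mem p) with S v in s
  ... | true = mem s

  ∩ʳ : v ∈ S ∩ T → v ∈ T
  ∩ʳ (mem p) with S v | T v in t
  ... | true | true = mem t

  ∖⁺ : v ∈ S → ¬ v ∈ T → v ∈ S ∖ T
  ∖⁺ (mem p) v∉T = mem (cong₂ (λ s t → s ∧ not t) p (∉⇒false v∉T))

  ∖ˡ : v ∈ S ∖ T → v ∈ S
  ∖ˡ (mem p) with S v in s
  ... | true = mem s

  ∖ʳ : v ∈ S ∖ T → ¬ v ∈ T
  ∖ʳ (mem p) (mem q) with S v | T v
  ∖ʳ (mem ()) (mem q) | true | true

  ∪ˡ : v ∈ S → v ∈ S ∪ T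
  ∪ˡ (mem p) = mem (cong (_∨ T v) p)

  ∪ʳ : v ∈ T → v ∈ S ∪ T
  ∪ʳ (mem p) = mem (trans (cong (S v ∨_) p) (∨-zeroʳ (S v)))

  ∪⁻ : v ∈ S ∪ T → v ∈ S ⊎ v ∈ T
  ∪⁻ (mem p) with S v in s | T v in t
  ... | true  | _    = inj₁ (mem s)
  ... | false | true = inj₂ (mem t)

abstract
  ∉∅ : ∀ {n} {v : Fin n} → ¬ v ∈ ∅
  ∉∅ (mem ())

  ∈⟦⟧⁻ : ∀ {n} {u v : Fin n} → v ∈ ⟦ u ⟧ → v ≡ u
  ∈⟦⟧⁻ {u = u} {v} (mem p) with v ≟ u
  ... | yes q = q

  ∈⟦⟧ : ∀ {n} (u : Fin n) → u ∈ ⟦ u ⟧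
  ∈⟦⟧ u = mem (dec-true (u ≟ u) refl)

module _ {n k : ℕ} {S : VSet n} {c : Fin n → Fin k} {v : Fin n} where abstract

  part⁺ : ∀ {i} → v ∈ S → c v ≡ i → v ∈ part S c i
  part⁺ (mem p) refl = mem (cong₂ _∧_ p (dec-true (c v ≟ c v) refl))

  part-colour : ∀ {i} → v ∈ part S c i → c v ≡ i
  part-colour {i} (mem p) with S v | c v ≟ i
  ... | true | yes q = q

  part-⊆ : ∀ {i} → v ∈ part S c i → v ∈ S
  part-⊆ (mem p) with S v in s
  ... | true = mem s

module _ {n : ℕ} where abstract

  card-cong : {S T : VSet n} → (∀ v → S v ≡ T v) → ∣ S ∣ ≡ ∣ T ∣
  card-cong eq = ∑-cong (allFin n) (λ v → cong χ (eq v))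

  card-∩ : (S T : VSet n) → ∣ S ∩ T ∣ ≡ ∑ (allFin n) (λ v → χ (S v) * χ (T v))
  card-∩ S T = ∑-cong (allFin n) pointwise
    where
    pointwise : ∀ v → χ (S v ∧ T v) ≡ χ (S v) * χ (T v)
    pointwise v with S v
    ... | true  = sym (+-identityʳ _)
    ... | false = refl

  card-mono : {S T : VSet n} → S ⊆ T → ∣ S ∣ ≤ ∣ T ∣
  card-mono {S} {T} S⊆T = ∑-mono (allFin n) λ v _ → pointwise v
    where
    pointwise : ∀ v → χ (S v) ≤ χ (T v)
    pointwise v with S v in s
    ... | false = z≤n
    ... | true rewrite holds (S⊆T (mem s)) = ≤-refl

  card-split : (S T : VSet n) → ∣ S ∣ ≡ ∣ S ∩ T ∣ + ∣ S ∖ T ∣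
  card-split S T = trans (∑-cong (allFin n) pointwise) (∑-+ (allFin n) _ _)
    where
    pointwise : ∀ v → χ (S v) ≡ χ (S v ∧ T v) + χ (S v ∧ not (T v))
    pointwise v with S v | T v
    ... | true  | true  = refl
    ... | true  | false = refl
    ... | false | _     = refl

  card-disjoint : {S T R : VSet n} → S ⊆ R → T ⊆ R → (∀ {v} → v ∈ S → ¬ v ∈ T) → ∣ S ∣ + ∣ T ∣ ≤ ∣ R ∣
  card-disjoint {S} {T} {R} S⊆R T⊆R disj =
    ≤-trans (≤-reflexive (sym (∑-+ (allFin n) _ _))) (∑-mono (allFin n) λ v _ → pointwise v)
    where
    pointwise : ∀ v → χ (S v) + χ (T v) ≤ χ (R v)
    pointwise v with S v in s | T v in t
    ... | true  | true  = ⊥-elim (disj (mem s) (mem t))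
    ... | true  | false rewrite holds (S⊆R (mem s)) = ≤-refl
    ... | false | true  rewrite holds (T⊆R (mem t)) = ≤-refl
    ... | false | false = z≤n

  card-positive : (S : VSet n) → 0 < ∣ S ∣ → ∃ (_∈ S)
  card-positive S h with ∑-positive (allFin n) (χ ∘ S) h
  ... | v , _ , p with S v in eq
  ...   | true = v , mem eq

  member-positive : {S : VSet n} {v : Fin n} → v ∈ S → 0 < ∣ S ∣
  member-positive {S} {v} (mem p) =
    ≤-trans (≤-reflexive (sym (cong χ p))) (∑-member (χ ∘ S) (∈-allFin v))

  card-full : ∣ full {n} ∣ ≡ n
  card-full = begin
    ∑ (allFin n) (λ _ → 1)   ≡⟨ ∑-const (allFin n) 1 ⟩
    length (allFin n) * 1    ≡⟨ *-identityʳ _ ⟩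
    length (allFin n)        ≡⟨ length-tabulate (id {A = Fin n}) ⟩
    n                        ∎
    where open ≡-Reasoning

  card-≤ : (S : VSet n) → ∣ S ∣ ≤ n
  card-≤ S = ≤-trans (card-mono λ _ → mem refl) (≤-reflexive card-full)

∑-indicator : ∀ {k} (j : Fin k) → ∑ (allFin k) (λ i → χ (does (j ≟ i))) ≡ 1
∑-indicator {k} j = trans (cong sum (map-tabulate {n = k} id (λ i → χ (does (j ≟ i))))) (go j)
  where
  zeros : ∀ k → sum (tabulate {n = k} (λ _ → 0)) ≡ 0
  zeros zero    = refl
  zeros (suc k) = zeros k
  go : ∀ {k} (j : Fin k) → sum (tabulate (λ i → χ (does (j ≟ i)))) ≡ 1
  go {suc k} zero = cong suc (zeros k)
  go (suc j)      = go j

module _ {n k : ℕ} (S : VSet n) (c : Fin n → Fin k) where abstract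

  -- Swap the two sums: a vertex of `S ∖ T` is counted for exactly one colour. With `T = N v` this
  -- splits the non-neighbours of `v` by class.
  card-parts : (T : VSet n) → ∑ (allFin k) (λ i → ∣ part S c i ∖ T ∣) ≡ ∣ S ∖ T ∣
  card-parts T =
    trans (∑-swap (allFin k) (allFin n) (λ i v → χ ((part S c i ∖ T) v)))
          (∑-cong (allFin n) pointwise)
    where
    pointwise : ∀ v → ∑ (allFin k) (λ i → χ ((part S c i ∖ T) v)) ≡ χ ((S ∖ T) v)
    pointwise v with S v | T v
    ... | false | _     = trans (∑-const (allFin k) 0) (*-zeroʳ (length (allFin k)))
    ... | true  | true  = trans (∑-cong (allFin k) (λ i → cong χ (∧-zeroʳ (does (c v ≟ i)))))
                                (trans (∑-const (allFin k) 0) (*-zeroʳ (length (allFin k))))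
    ... | true  | false = trans (∑-cong (allFin k) (λ i → cong χ (∧-identityʳ (does (c v ≟ i)))))
                                (∑-indicator (c v))

  card-parts₀ : ∑ (allFin k) (λ i → ∣ part S c i ∣) ≡ ∣ S ∣
  card-parts₀ = begin
    ∑ (allFin k) (λ i → ∣ part S c i ∣)                       ≡⟨ ∑-cong (allFin k) (λ i → without-∅ (part S c i)) ⟩
    ∑ (allFin k) (λ i → ∣ part S c i ∖ ∅ ∣)       ≡⟨ card-parts ∅ ⟩
    ∣ S ∖ ∅ ∣                                     ≡⟨ without-∅ S ⟨
    ∣ S ∣                                                     ∎
    where
    open ≡-Reasoning
    without-∅ : (T : VSet n) → ∣ T ∣ ≡ ∣ T ∖ ∅ ∣
    without-∅ T = ∑-cong (allFin n) (λ v → cong χ (sym (∧-identityʳ (T v))))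

-- Colourings and independent sets

Unique-resp-↭ : ∀ {A : Set} {xs ys : List A} → xs ↭ ys → Unique xs → Unique ys
Unique-resp-↭ p = ↭ₛ.Unique-resp-↭ (setoid _) (↭⇒↭ₛ p)

colours-from : ∀ {k} (i : Fin (suc k)) → ∃ λ ks → allFin (suc k) ↭ i ∷ ks × length ks ≡ k
colours-from {k} i with bring-to-front (∈-allFin i)
... | ks , p = ks , p , cong pred (trans (sym (↭-length p)) (length-tabulate (id {A = Fin (suc k)})))

colours-from₂ : ∀ {k} {i j : Fin (suc (suc k))} → i ≢ j →
  ∃ λ ks → allFin (suc (suc k)) ↭ i ∷ j ∷ ks × length ks ≡ k
colours-from₂ {i = i} {j} i≢j with colours-from i
... | ks , p , len with ∈-resp-↭ p (∈-allFin j)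
...   | here j≡i = ⊥-elim (i≢j (sym j≡i))
...   | there j∈ with bring-to-front j∈
...     | ls , q = ls , ↭-trans p (prep _ q) , cong pred (trans (sym (↭-length q)) len)

AllPairs-lookup : ∀ {A : Set} {R : A → A → Set} {xs : List A} → AllPairs R xs →
  ∀ {i j : Fin (length xs)} → i Fin.< j → R (lookup xs i) (lookup xs j)
AllPairs-lookup (r ∷ rs) {zero}  {suc j} _       = All.lookup r (∈-lookup j)
AllPairs-lookup (r ∷ rs) {suc i} {suc j} (s≤s p) = AllPairs-lookup rs p

unique-length : ∀ {k} {js : List (Fin k)} → Unique js → length js ≤ k
unique-length {k} {js} uniq = ≮⇒≥ λ k<js →
  let i , j , i<j , eq = pigeonhole k<js (lookup js) in AllPairs-lookup uniq i<j eq

module Colouring {n : ℕ} (G : Graph n) where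

  N : Fin n → VSet n
  N = adj G

  N-sym : ∀ {u v} → v ∈ N u → u ∈ N v
  N-sym {u} {v} (mem p) = mem (trans (adj-sym G v u) p)

  N-irrefl : ∀ {v} → ¬ v ∈ N v
  N-irrefl {v} (mem p) with trans (sym p) (irrefl G v)
  ... | ()

  Indep : VSet n → Set
  Indep S = ∀ {u v} → u ∈ S → v ∈ S → ¬ v ∈ N u

  Proper : ∀ {k} → VSet n → (Fin n → Fin k) → Set
  Proper S c = ∀ {u v} → u ∈ S → v ∈ S → v ∈ N u → c u ≢ c v

  Col : ℕ → VSet n → Set
  Col k S = Σ (Fin n → Fin k) (Proper S)

  LocallyCol : ℕ → VSet n → Set
  LocallyCol k U = ∀ {w} → w ∈ U → Col k (U ∩ N w)

  Col-⊆ : ∀ {k S T} → S ⊆ T → Col k T → Col k S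
  Col-⊆ S⊆T (c , p) = c , λ u∈ v∈ → p (S⊆T u∈) (S⊆T v∈)

  part-indep : ∀ {k S} {c : Fin n → Fin k} {i} → Proper S c → Indep (part S c i)
  part-indep p u∈ v∈ vu = p (part-⊆ u∈) (part-⊆ v∈) vu (trans (part-colour u∈) (sym (part-colour v∈)))

  opaque
    add-class : ∀ {k U A} → Indep A → Col k (U ∖ A) → Col (suc k) U
    add-class {k} {U} {A} ind (c , p) = c⁺ , proper
      where
      c⁺ : Fin n → Fin (suc k)
      c⁺ v = if A v then zero else suc (c v)
      proper : Proper U c⁺
      proper {u} {v} u∈ v∈ uv eq with A u in au | A v in av
      ... | true  | true  = ind (mem au) (mem av) uv
      ... | false | false = p (∖⁺ u∈ (∉ au)) (∖⁺ v∈ (∉ av)) uv (suc-injective eq)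
        where
        ∉ : ∀ {v} → A v ≡ false → ¬ v ∈ A
        ∉ av (mem av′) = contradiction (trans (sym av) av′) λ ()

  opaque
    drop-class : ∀ {k S T} {c : Fin n → Fin (suc (suc k))} (i : Fin (suc (suc k))) → Proper S c →
      T ⊆ S → (∀ {v} → v ∈ T → c v ≢ i) → Col (suc k) T
    drop-class {k} {S} {T} {c} i p T⊆S avoid = c⁻ , proper
      where
      c⁻ : Fin n → Fin (suc k)
      c⁻ v with i ≟ c v
      -- Never reached on `T`; the default value is why `suc k` colours remain rather than `k`.
      ... | yes _ = zero
      ... | no i≢ = punchOut i≢
      proper : Proper T c⁻
      proper {u} {v} u∈ v∈ uv eq with i ≟ c u | i ≟ c v
      ... | yes q | _     = avoid u∈ (sym q)
      ... | no _  | yes q = avoid v∈ (sym q)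
      ... | no q  | no r  = p (T⊆S u∈) (T⊆S v∈) uv (punchOut-injective q r eq)

  Largest : VSet n → VSet n → Set
  Largest U A = A ⊆ U × Indep A × (∀ {I} → I ⊆ U → Indep I → ∣ I ∣ ≤ ∣ A ∣)

  opaque
    -- Improve the current set while a larger independent one exists. Candidates are vectors, so
    -- that the search is decidable. The invariant `n ≤ fuel + ∣ A ∣` leaves no room for improvement
    -- once the fuel is spent.
    largest-indep : ∀ U → ∃ (Largest U)
    largest-indep U = search n ∅ (⊥-elim ∘ ∉∅) (λ u∈ _ → ⊥-elim (∉∅ u∈)) (m≤m+n n _)
      where
      Better : VSet n → Subset n → Set
      Better A p = (∀ v → v ∈ Vec.lookup p → v ∈ U)
                 × (∀ u v → u ∈ Vec.lookup p → v ∈ Vec.lookup p → ¬ v ∈ N u)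
                 × ∣ A ∣ < ∣ Vec.lookup p ∣
      better? : ∀ A → Dec (∃ (Better A))
      better? A = anySubset? λ p →
        all? (λ v → (v ∈? Vec.lookup p) →-dec (v ∈? U))
        ×-dec all? (λ u → all? λ v → (u ∈? Vec.lookup p) →-dec ((v ∈? Vec.lookup p) →-dec ¬? (v ∈? N u)))
        ×-dec (_ <? _)
      back : {I : VSet n} {v : Fin n} → v ∈ Vec.lookup (Vec.tabulate I) → v ∈ I
      back {I} {v} (mem p) = mem (trans (sym (lookup∘tabulate I v)) p)
      search : ∀ fuel A → A ⊆ U → Indep A → n ≤ fuel + ∣ A ∣ → ∃ (Largest U)
      search fuel A A⊆U ind big with better? A
      search fuel A A⊆U ind big | no none = A , A⊆U , ind , λ {I} I⊆U indI → ≮⇒≥ λ A<I →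
        none (Vec.tabulate I
             , (λ v v∈ → I⊆U (back v∈))
             , (λ u v u∈ v∈ → indI (back u∈) (back v∈))
             , ≤-trans A<I (≤-reflexive (card-cong λ v → sym (lookup∘tabulate I v))))
      search zero A A⊆U ind big | yes (p , _ , _ , A<p) =
        ⊥-elim (<-irrefl refl (≤-trans A<p (≤-trans (card-≤ (Vec.lookup p)) big)))
      search (suc fuel) A A⊆U ind big | yes (p , p⊆U , indp , A<p) =
        search fuel (Vec.lookup p) (p⊆U _) (indp _ _)
          (≤-trans big (≤-trans (≤-reflexive (sym (+-suc fuel ∣ A ∣))) (+-monoʳ-≤ fuel A<p)))

  opaque
    -- Otherwise `A ∪ ⟦ u ⟧` would be a larger independent set.
    largest-dominates : ∀ {U A u} → Largest U A → u ∈ U → ¬ u ∈ A → ∃ λ y → y ∈ A × y ∈ N u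
    largest-dominates {U} {A} {u} (A⊆U , ind , max) u∈U u∉A
      with any? (λ y → (y ∈? A) ×-dec (y ∈? N u))
    ... | yes found = found
    ... | no none = ⊥-elim (<-irrefl refl (≤-trans bigger (max A⁺⊆U A⁺-indep)))
      where
      A⁺ : VSet n
      A⁺ = A ∪ ⟦ u ⟧
      A⁺⊆U : A⁺ ⊆ U
      A⁺⊆U v∈ with ∪⁻ v∈
      ... | inj₁ a = A⊆U a
      ... | inj₂ q = subst (_∈ U) (sym (∈⟦⟧⁻ q)) u∈U
      A⁺-indep : Indep A⁺
      A⁺-indep {v} {w} v∈ w∈ vw with ∪⁻ v∈ | ∪⁻ w∈
      ... | inj₁ a | inj₁ b = ind a b vw
      ... | inj₁ a | inj₂ q = none (v , a , N-sym (subst (_∈ N v) (∈⟦⟧⁻ q) vw))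
      ... | inj₂ q | inj₁ b = none (w , b , subst (λ t → w ∈ N t) (∈⟦⟧⁻ q) vw)
      ... | inj₂ q | inj₂ r = N-irrefl (subst₂ (λ s t → t ∈ N s) (∈⟦⟧⁻ q) (∈⟦⟧⁻ r) vw)
      bigger : suc ∣ A ∣ ≤ ∣ A⁺ ∣
      bigger = ≤-trans (≤-trans (≤-reflexive (+-comm 1 ∣ A ∣)) (+-monoʳ-≤ ∣ A ∣ (member-positive (∈⟦⟧ u))))
        (card-disjoint ∪ˡ ∪ʳ λ a q → u∉A (subst (_∈ A) (∈⟦⟧⁻ q) a))

  opaque
    -- The clique `L` uses all colours but one, which is left for both `u` and `z`.
    same-colour : ∀ {k S L} {c : Fin n → Fin (suc k)} {u z} → Proper S c → length L ≡ k →
      AllPairs (λ u v → v ∈ N u) L → All (λ x → x ∈ S × x ∈ N u × x ∈ N z) L → u ∈ S → z ∈ S → c u ≡ c z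
    same-colour {k} {S} {L} {c} {u} {z} p len cl h u∈ z∈ with c u ≟ c z
    ... | yes eq = eq
    ... | no ne = ⊥-elim (<-irrefl refl (subst (λ l → suc (suc l) ≤ suc k) (trans (length-map c L) len)
      (unique-length ((ne ∷ differs u u∈ (All.map (λ (s , a , _) → s , a) h))
        ∷ differs z z∈ (All.map (λ (s , _ , b) → s , b) h) ∷ images cl (All.map proj₁ h)))))
      where
      differs : ∀ v → v ∈ S → ∀ {L} → All (λ x → x ∈ S × x ∈ N v) L → All (λ j → c v ≢ j) (map c L)
      differs v v∈ []             = []
      differs v v∈ ((s , a) ∷ hs) = p v∈ s a ∷ differs v v∈ hs
      images : ∀ {L} → AllPairs (λ u v → v ∈ N u) L → All (_∈ S) L → Unique (map c L)
      images []       []       = []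
      images (r ∷ rs) (s ∷ ss) = differs _ s (All.zip (ss , r)) ∷ images rs ss

-- Graphs with few non-neighbours

module Dense {n : ℕ} (G : Graph n) (D : ℕ) (missing : ∀ v → ∣ full ∖ adj G v ∣ ≤ D) where

  open Colouring G

  missing-⊆ : ∀ {v S} → ∣ S ∖ N v ∣ ≤ D
  missing-⊆ {v} = ≤-trans (card-mono λ x∈ → ∖⁺ (mem refl) (∖ʳ x∈)) (missing v)

  -- `R` and `S ∖ N v` are disjoint sets of non-neighbours of `v`. This is the main counting tool:
  -- known non-neighbours outside `S` reduce what `v` can miss in `S`.
  missing-beyond : ∀ {v R S} → (∀ {x} → x ∈ R → ¬ x ∈ N v) → (∀ {x} → x ∈ R → ¬ x ∈ S) →
    ∣ R ∣ + ∣ S ∖ N v ∣ ≤ D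
  missing-beyond {v} R∩N R∩S = ≤-trans
    (card-disjoint (λ x∈ → ∖⁺ (mem refl) (R∩N x∈)) (λ x∈ → ∖⁺ (mem refl) (∖ʳ x∈)) (λ x∈R x∈ → R∩S x∈R (∖ˡ x∈)))
    (missing v)

  card-neighbours : ∀ S v → ∣ S ∣ ≤ ∣ S ∩ N v ∣ + D
  card-neighbours S v = ≤-trans (≤-reflexive (card-split S (N v))) (+-monoʳ-≤ _ missing-⊆)

  indep-card : ∀ {A} → Indep A → ∣ A ∣ ≤ D
  indep-card {A} ind with any? (_∈? A)
  ... | yes (x , x∈) = ≤-trans (card-mono (λ y∈ → ∖⁺ y∈ (ind x∈ y∈))) missing-⊆
  ... | no none      = ≤-trans (≮⇒≥ (λ pos → none (card-positive A pos))) z≤n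

  module _ {b} {S A : VSet n} {c : Fin n → Fin (suc (suc b))}
    (proper : Proper S c) (A-indep : Indep A)
    (A-max : ∀ {I} → I ⊆ S → Indep I → ∣ I ∣ ≤ ∣ A ∣) where

    class : Fin (suc (suc b)) → VSet n
    class = part S c

    class-card : ∀ i → ∣ class i ∣ ≤ ∣ A ∣
    class-card i = A-max part-⊆ (part-indep proper)

    -- If x and x′ lie in distinct classes P and P′, then x misses A ∪ P and x′ misses A ∪ P′.
    opaque
      one-class : 2 * D + b * ∣ A ∣ < ∣ S ∣ + ∣ A ∣ →
        ∀ {x x′} → x ∈ A → x ∈ S → x′ ∈ A → x′ ∈ S → c x ≡ c x′
      one-class big {x} {x′} x∈A x∈S x′∈A x′∈S with c x ≟ c x′
      ... | yes eq = eq
      ... | no  ne with colours-from₂ ne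
      ...   | ks , perm , len = ⊥-elim (n≮0 (linear
                (∣ A ∣ ∷ b * ∣ A ∣ ∷ D ∷ ∣ S ∣ ∷ ∣ class i ∣ ∷ ∣ class j ∣ ∷ ∑ ks (λ l → ∣ class l ∣)
                  ∷ ∣ class i ∩ A ∣ ∷ ∣ class j ∩ A ∣ ∷ ∣ class i ∖ A ∣ ∷ ∣ class j ∖ A ∣ ∷ [])
                (λ { (α ∷ bα ∷ d ∷ σ ∷ pᵢ ∷ pⱼ ∷ r ∷ xᵢ ∷ xⱼ ∷ yᵢ ∷ yⱼ ∷ []) →
                  (con 1 ⊞ (2 ⊠ d ⊞ bα) ≼ σ ⊞ α) ∷ (σ ≼ pᵢ ⊞ (pⱼ ⊞ r)) ∷ (r ≼ bα) ∷ (α ⊞ yᵢ ≼ d) ∷ (α ⊞ yⱼ ≼ d)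
                  ∷ (xᵢ ⊞ xⱼ ≼ α) ∷ (pᵢ ≼ xᵢ ⊞ yᵢ) ∷ (pⱼ ≼ xⱼ ⊞ yⱼ) ∷ [] ⊢ con 1 ≼ con 0 })
                (big , ≤-reflexive (sym total) , rest , outside x∈A x∈S , outside x′∈A x′∈S , inside
                  , ≤-reflexive (card-split (class i) A) , ≤-reflexive (card-split (class j) A))))
        where
        i j : Fin (suc (suc b))
        i = c x
        j = c x′
        total : ∣ class i ∣ + (∣ class j ∣ + ∑ ks (λ i → ∣ class i ∣)) ≡ ∣ S ∣
        total = trans (sym (∑-↭ (λ i → ∣ class i ∣) perm)) (card-parts₀ S c)
        rest : ∑ ks (λ i → ∣ class i ∣) ≤ b * ∣ A ∣
        rest = ≤-trans (∑-mono ks (λ i _ → class-card i)) (≤-reflexive (trans (∑-const ks _) (cong (_* ∣ A ∣) len)))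
        outside : ∀ {x} → x ∈ A → x ∈ S → ∣ A ∣ + ∣ class (c x) ∖ A ∣ ≤ D
        outside x∈A x∈S = ≤-trans
          (+-monoʳ-≤ _ (card-mono λ y∈ → ∖⁺ y∈ (part-indep proper (part⁺ x∈S refl) (∖ˡ y∈))))
          (missing-beyond (A-indep x∈A) (λ y∈A y∈ → ∖ʳ y∈ y∈A))
        inside : ∣ class i ∩ A ∣ + ∣ class j ∩ A ∣ ≤ ∣ A ∣
        inside = card-disjoint ∩ʳ ∩ʳ λ y∈ y∈′ → ne (trans (sym (part-colour (∩ˡ y∈))) (part-colour (∩ˡ y∈′)))

  opaque
    -- Pick one vertex from each candidate set `X k`. A vertex picked in `P k` removes at most `E k`
    -- candidates from any other part, and the last hypothesis says that `X k` outlasts the losses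
    -- caused by all other parts.
    greedy : ∀ {I : Set} (P X : I → VSet n) (E : I → ℕ) {Z : Fin n → Set} (ks : List I) →
      Unique ks →
      (∀ k {x} → x ∈ X k → x ∈ P k) →
      (∀ k {x} → x ∈ X k → Z x) →
      (∀ {k l x} → l ≢ k → x ∈ P k → ∣ P l ∖ N x ∣ ≤ E k) →
      (∀ {k} → k ∈ₗ ks → ∑ ks E < ∣ X k ∣ + E k) →
      ∃ λ L → length L ≡ length ks × AllPairs (λ u v → v ∈ N u) L × All Z L
    greedy P X E [] _ _ _ _ _ = [] , refl , [] , []
    greedy P X E {Z} (k ∷ ks) (k∉ ∷ uniq) X⊆P X⊆Z miss big
      with card-positive (X k) (+-cancelʳ-< (E k) _ _ (≤-trans (s≤s (m≤m+n (E k) _)) (big (here refl))))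
    -- Adding adjacency to `x` to the predicate `Z` makes the rest of the clique complete to `x`.
    ... | x , x∈ with greedy P (λ l → X l ∩ N x) E {λ y → Z y × y ∈ N x} ks uniq
      (λ l y∈ → X⊆P l (∩ˡ y∈)) (λ l y∈ → X⊆Z l (∩ˡ y∈) , ∩ʳ y∈) miss big′
      where
      big′ : ∀ {l} → l ∈ₗ ks → ∑ ks E < ∣ X l ∩ N x ∣ + E l
      big′ {l} l∈ = linear
        (∑ ks E ∷ E k ∷ E l ∷ ∣ X l ∣ ∷ ∣ X l ∩ N x ∣ ∷ ∣ X l ∖ N x ∣ ∷ [])
        (λ { (t ∷ e ∷ f ∷ a ∷ a′ ∷ m ∷ []) →
          (con 1 ⊞ (e ⊞ t) ≼ a ⊞ f) ∷ (a ≼ a′ ⊞ m) ∷ (m ≼ e) ∷ [] ⊢ con 1 ⊞ t ≼ a′ ⊞ f })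
        (big (there l∈) , ≤-reflexive (card-split (X l) (N x)) ,
          ≤-trans (card-mono λ y∈ → ∖⁺ (X⊆P l (∖ˡ y∈)) (∖ʳ y∈))
            (miss (λ l≡k → All.lookup k∉ l∈ (sym l≡k)) (X⊆P k x∈)))
    ...   | L , len , cl , L⊆ = x ∷ L , cong suc len , All.map proj₂ L⊆ ∷ cl , X⊆Z k x∈ ∷ All.map proj₁ L⊆

-- Cliques through the colour classes of a neighbourhood

module Transversal {n : ℕ} (G : Graph n) (D : ℕ) (missing : ∀ v → ∣ full ∖ adj G v ∣ ≤ D) where

  open Colouring G
  open Dense G D missing

  -- In the application S is the neighbourhood of a vertex w ∉ A and uy is an edge with
  -- u ∈ S coloured like A; inside N r the clique w ∷ L forces u and z, hence u and y, to share a colour.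
  module _ {b} {S A : VSet n} {c : Fin n → Fin (3 + b)}
    (proper : Proper S c) (A-indep : Indep A)
    (A-max : ∀ {I} → I ⊆ S → Indep I → ∣ I ∣ ≤ ∣ A ∣)
    (S-big : (2 + b) * D < ∣ S ∣)
    {i₀ : Fin (3 + b)} (A-class : ∀ {x} → x ∈ A → x ∈ S → c x ≡ i₀)
    {u z y : Fin n} (u∈S : u ∈ S) (cu≡i₀ : c u ≡ i₀) (z∈A : z ∈ A) (z∈S : z ∈ S) (y∈A : y ∈ A) where

    private
      P X Y : Fin (3 + b) → VSet n
      P = part S c
      X i = (P i ∩ N u) ∩ N z
      Y i = X i ∩ N y

      -- A vertex of `P i` misses the whole of `P i`, so `E i` is what it can still miss elsewhere.
      s E : Fin (3 + b) → ℕ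
      s i = ∣ P i ∣
      E i = D ∸ s i

      μ : Fin n → Fin (3 + b) → ℕ
      μ v i = ∣ P i ∖ N v ∣

      -- The same allowance for a vertex of `A`, which misses all of `A`.
      β : ℕ
      β = D ∸ ∣ A ∣

      P-card : ∀ i → s i ≤ ∣ A ∣
      P-card i = A-max part-⊆ (part-indep proper)

      s+E : ∀ i → s i + E i ≡ D
      s+E i = m+[n∸m]≡n (≤-trans (P-card i) (indep-card A-indep))

      A+β : ∣ A ∣ + β ≡ D
      A+β = m+[n∸m]≡n (indep-card A-indep)

      β≤E : ∀ i → β ≤ E i
      β≤E i = ∸-monoʳ-≤ D (P-card i)

      complement : ∀ {a m e} → a + m ≤ D → a + e ≡ D → m ≤ e
      complement {a} h refl = +-cancelˡ-≤ a _ _ h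

      s≤X : ∀ i → s i ≤ ∣ X i ∣ + (μ u i + μ z i)
      s≤X i = linear
        (s i ∷ ∣ P i ∩ N u ∣ ∷ ∣ X i ∣ ∷ ∣ (P i ∩ N u) ∖ N z ∣ ∷ μ u i ∷ μ z i ∷ [])
        (λ { (s ∷ p ∷ x ∷ q ∷ mᵤ ∷ m ∷ []) → (s ≼ p ⊞ mᵤ) ∷ (p ≼ x ⊞ q) ∷ (q ≼ m) ∷ [] ⊢ s ≼ x ⊞ (mᵤ ⊞ m) })
        (≤-reflexive (card-split (P i) (N u)) , ≤-reflexive (card-split (P i ∩ N u) (N z))
          , card-mono λ x∈ → ∖⁺ (∩ˡ (∖ˡ x∈)) (∖ʳ x∈))

      drop-N : ∀ {v} (R : VSet n) i → R ⊆ P i → ∣ R ∣ ≤ ∣ R ∩ N v ∣ + μ v i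
      drop-N {v} R i R⊆ = ≤-trans (≤-reflexive (card-split R (N v)))
        (+-monoʳ-≤ _ (card-mono λ x∈ → ∖⁺ (R⊆ (∖ˡ x∈)) (∖ʳ x∈)))

      X⊆P : ∀ {i} → X i ⊆ P i
      X⊆P x∈ = ∩ˡ (∩ˡ x∈)

      μ-total : ∀ v → ∑ (allFin (3 + b)) (μ v) ≤ D
      μ-total v = ≤-trans (≤-reflexive (card-parts S c (N v))) missing-⊆

      s≤μ : ∀ {v i} → v ∈ P i → s i ≤ μ v i
      s≤μ v∈ = card-mono λ x∈ → ∖⁺ x∈ (part-indep proper v∈ x∈)

      μ-cross : ∀ {k l x} → l ≢ k → x ∈ P k → μ x l ≤ E k
      μ-cross {k} l≢k x∈ = complement
        (missing-beyond (part-indep proper x∈) λ p q → l≢k (trans (sym (part-colour q)) (part-colour p)))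
        (s+E k)

      μ-rest : ∀ {v i ks} → allFin (3 + b) ↭ i ∷ ks → v ∈ P i → ∑ ks (μ v) ≤ E i
      μ-rest {v} {i} perm v∈ = complement
        (≤-trans (+-monoˡ-≤ _ (s≤μ v∈)) (≤-trans (≤-reflexive (sym (∑-↭ (μ v) perm))) (μ-total v)))
        (s+E i)

      -- `v` misses `A ∖ S`, which is outside `S`, and `A ∩ S`, which is inside the class `i₀`; so
      -- all of `A` is charged before the other classes.
      μ-rest-A : ∀ {v ks} → allFin (3 + b) ↭ i₀ ∷ ks → v ∈ A → ∑ ks (μ v) ≤ β
      μ-rest-A {v} {ks} perm v∈ = complement
        (linear
          (∣ A ∣ ∷ ∣ A ∩ S ∣ ∷ ∣ A ∖ S ∣ ∷ μ v i₀ ∷ ∑ ks (μ v) ∷ ∣ S ∖ N v ∣ ∷ D ∷ [])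
          (λ { (α ∷ i ∷ o ∷ p ∷ m ∷ t ∷ d ∷ []) →
            (α ≼ i ⊞ o) ∷ (i ≼ p) ∷ (p ⊞ m ≼ t) ∷ (o ⊞ t ≼ d) ∷ [] ⊢ α ⊞ m ≼ d })
          (≤-reflexive (card-split A S)
          , card-mono (λ x∈ → ∖⁺ (part⁺ (∩ʳ x∈) (A-class (∩ˡ x∈) (∩ʳ x∈))) (A-indep v∈ (∩ˡ x∈)))
          , ≤-reflexive (trans (sym (∑-↭ (μ v) perm)) (card-parts S c (N v)))
          , missing-beyond (λ x∈ → A-indep v∈ (∖ˡ x∈)) ∖ʳ))
        A+β

      u∈P : u ∈ P i₀
      u∈P = part⁺ u∈S cu≡i₀

    -- `r` and `L` will represent the `2 + b` classes other than `i₀`, one vertex each. Only `r` has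
    -- to see `y`: inside `N r`, the vertices `y` and `z` are compared through `A`, not through `L`.
    Transversal : Set
    Transversal = ∃₂ λ r L → r ∈ S × r ∈ N u × r ∈ N z × r ∈ N y × length L ≡ suc b
      × AllPairs (λ v w → w ∈ N v) L × All (λ x → x ∈ S × x ∈ N u × x ∈ N z × x ∈ N r) L

    private
      module Choose {ks} (perm : allFin (3 + b) ↭ i₀ ∷ ks) (len : length ks ≡ 2 + b) where

        ΣE : ℕ
        ΣE = ∑ ks E

        -- The allowances of the `3 + b` classes add up to `(3 + b) * D` minus the size of `S`.
        E-total : E i₀ + ΣE < D
        E-total = linear
          (D ∷ b * D ∷ ∑ (i₀ ∷ ks) s ∷ E i₀ ∷ ΣE ∷ [])
          (λ { (d ∷ bd ∷ σ ∷ e ∷ t ∷ []) →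
            (con 1 ⊞ (d ⊞ (d ⊞ bd)) ≼ σ) ∷ (σ ⊞ (e ⊞ t) ≼ d ⊞ (d ⊞ (d ⊞ bd))) ∷ [] ⊢ con 1 ⊞ (e ⊞ t) ≼ d })
          (subst (_ <_) (trans (sym (card-parts₀ S c)) (∑-↭ s perm)) S-big , ≤-reflexive (begin
            s i₀ + ∑ ks s + (E i₀ + ΣE)          ≡⟨ ∑-+ (i₀ ∷ ks) s E ⟨
            ∑ (i₀ ∷ ks) (λ i → s i + E i)       ≡⟨ ∑-cong (i₀ ∷ ks) s+E ⟩
            ∑ (i₀ ∷ ks) (λ _ → D)               ≡⟨ ∑-const (i₀ ∷ ks) D ⟩
            suc (length ks) * D                 ≡⟨ cong (λ l → suc l * D) len ⟩
            (3 + b) * D                         ∎))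
          where open ≡-Reasoning

        -- At most one part is too small to be visited last.
        two-tight : ∀ {i l ls} → ks ↭ i ∷ ls → l ∈ₗ ls → ∣ X i ∣ + E i ≤ ΣE → ∣ X l ∣ + E l ≤ ΣE → ⊥
        two-tight {i} {l} {ls} p l∈ hᵢ hₗ = n≮0 (linear
          (D ∷ ΣE ∷ E i₀ ∷ β ∷ s i ∷ E i ∷ s l ∷ E l ∷ ∣ X i ∣ ∷ ∣ X l ∣
            ∷ μ u i ∷ μ z i ∷ μ u l ∷ μ z l ∷ ∑ ls (μ u) ∷ ∑ ls (μ z) ∷ [])
          (λ { (d ∷ t ∷ e₀ ∷ β ∷ sᵢ ∷ eᵢ ∷ sₗ ∷ eₗ ∷ xᵢ ∷ xₗ ∷ uᵢ ∷ zᵢ ∷ uₗ ∷ zₗ ∷ u ∷ z ∷ []) →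
            (con 1 ⊞ (e₀ ⊞ t) ≼ d) ∷ (con 1 ⊞ (e₀ ⊞ t) ≼ d) ∷ (β ≼ e₀) ∷ (d ≼ sᵢ ⊞ eᵢ) ∷ (d ≼ sₗ ⊞ eₗ)
            ∷ (sᵢ ≼ xᵢ ⊞ (uᵢ ⊞ zᵢ)) ∷ (sₗ ≼ xₗ ⊞ (uₗ ⊞ zₗ)) ∷ (xᵢ ⊞ eᵢ ≼ t) ∷ (xₗ ⊞ eₗ ≼ t)
            ∷ (uᵢ ⊞ u ≼ e₀) ∷ (zᵢ ⊞ z ≼ β) ∷ (uₗ ≼ u) ∷ (zₗ ≼ z) ∷ [] ⊢ con 1 ≼ con 0 })
          (E-total , E-total , β≤E i₀ , ≤-reflexive (sym (s+E i)) , ≤-reflexive (sym (s+E l))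
          , s≤X i , s≤X l , hᵢ , hₗ
          , ≤-trans (≤-reflexive (sym (∑-↭ (μ u) p))) (μ-rest perm u∈P)
          , ≤-trans (≤-reflexive (sym (∑-↭ (μ z) p))) (μ-rest-A perm z∈A)
          , ∑-member (μ u) l∈ , ∑-member (μ z) l∈))

        opaque
          -- A part violating the greedy bound, if there is one, is visited first, so the bound is
          -- available for all later parts.
          first-part : ∃₂ λ i ls → ks ↭ i ∷ ls × (∀ {l} → l ∈ₗ ls → ΣE < ∣ X l ∣ + E l)
          first-part with Any.any? (λ i → ∣ X i ∣ + E i ≤? ΣE) ks
          ... | yes tight with find tight
          ...   | i , i∈ , hᵢ with bring-to-front i∈
          ...     | ls , p = i , ls , p , λ l∈ → ≰⇒> (two-tight p l∈ hᵢ)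
          first-part | no none = split ks len none
            where
            split : ∀ ks → length ks ≡ 2 + b → ¬ Any (λ i → ∣ X i ∣ + E i ≤ ΣE) ks →
              ∃₂ λ i ls → ks ↭ i ∷ ls × (∀ {l} → l ∈ₗ ls → ΣE < ∣ X l ∣ + E l)
            split (i ∷ ls) _ none = i , ls , ↭-refl , λ l∈ → ≰⇒> λ h → none (there (lose l∈ h))

        module _ {i ls} (p : ks ↭ i ∷ ls) (loose : ∀ {l} → l ∈ₗ ls → ΣE < ∣ X l ∣ + E l) where

          len-ls : length ls ≡ suc b
          len-ls = cong pred (trans (sym (↭-length p)) len)

          uniq : Unique (i₀ ∷ i ∷ ls)
          uniq = Unique-resp-↭ (↭-trans perm (prep i₀ p)) (allFin⁺ (3 + b))

          ΣE≡ : ΣE ≡ E i + ∑ ls E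
          ΣE≡ = ∑-↭ E p

          β≤ls : β ≤ ∑ ls E
          β≤ls = go ls len-ls
            where
            go : ∀ ls → length ls ≡ suc b → β ≤ ∑ ls E
            go (l ∷ ls) _ = ≤-trans (β≤E l) (m≤m+n _ _)

          E-total′ : E i₀ + (E i + ∑ ls E) < D
          E-total′ = subst (λ t → E i₀ + t < D) ΣE≡ E-total

          μu : μ u i + ∑ ls (μ u) ≤ E i₀
          μu = ≤-trans (≤-reflexive (sym (∑-↭ (μ u) p))) (μ-rest perm u∈P)

          μA : ∀ {v} → v ∈ A → μ v i + ∑ ls (μ v) ≤ β
          μA {v} v∈ = ≤-trans (≤-reflexive (sym (∑-↭ (μ v) p))) (μ-rest-A perm v∈)

          opaque
            -- Inside part `i`, `u` misses at most `E i₀` and `z` at most `β`. As `ls` is nonempty,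
            -- `β` is at most its total allowance, and `E-total′` leaves a vertex over.
            first-nonempty : ∃ (_∈ X i)
            first-nonempty = card-positive (X i) (linear
              (D ∷ E i₀ ∷ E i ∷ ∑ ls E ∷ β ∷ s i ∷ ∣ X i ∣ ∷ μ u i ∷ μ z i ∷ ∑ ls (μ u) ∷ ∑ ls (μ z) ∷ [])
              (λ { (d ∷ e₀ ∷ e ∷ t ∷ β ∷ s ∷ x ∷ uᵢ ∷ zᵢ ∷ u ∷ z ∷ []) →
                (con 1 ⊞ (e₀ ⊞ (e ⊞ t)) ≼ d) ∷ (β ≼ t) ∷ (d ≼ s ⊞ e) ∷ (s ≼ x ⊞ (uᵢ ⊞ zᵢ))
                ∷ (uᵢ ⊞ u ≼ e₀) ∷ (zᵢ ⊞ z ≼ β) ∷ [] ⊢ con 1 ≼ x })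
              (E-total′ , β≤ls , ≤-reflexive (sym (s+E i)) , s≤X i , μu , μA z∈A))

          Z : Fin n → Set
          Z x = x ∈ S × x ∈ N u × x ∈ N z

          X⊆Z : ∀ {i x} → x ∈ X i → Z x
          X⊆Z x∈ = part-⊆ (X⊆P x∈) , ∩ʳ (∩ˡ x∈) , ∩ʳ x∈

          opaque
            -- Part `i` supplies `r`, and the greedy choice in the other parts supplies all of `L`.
            from-first : ∀ {r} → r ∈ Y i → Transversal
            from-first {r} r∈ with uniq
            ... | _ ∷ i∉ ∷ uniq-ls with greedy P (λ l → X l ∩ N r) E {λ x → Z x × x ∈ N r} ls uniq-ls
                    (λ l x∈ → X⊆P (∩ˡ x∈)) (λ l x∈ → X⊆Z (∩ˡ x∈) , ∩ʳ x∈) μ-cross room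
              where
              room : ∀ {l} → l ∈ₗ ls → ∑ ls E < ∣ X l ∩ N r ∣ + E l
              room {l} l∈ = linear
                (E i ∷ ∑ ls E ∷ E l ∷ ∣ X l ∣ ∷ ∣ X l ∩ N r ∣ ∷ μ r l ∷ [])
                (λ { (e ∷ t ∷ f ∷ x ∷ x′ ∷ m ∷ []) →
                  (con 1 ⊞ (e ⊞ t) ≼ x ⊞ f) ∷ (x ≼ x′ ⊞ m) ∷ (m ≼ e) ∷ [] ⊢ con 1 ⊞ t ≼ x′ ⊞ f })
                (subst (_< _) ΣE≡ (loose l∈) , drop-N (X l) l X⊆P
                , μ-cross (λ l≡i → All.lookup i∉ l∈ (sym l≡i)) (X⊆P (∩ˡ r∈)))
            ...   | L , len-L , clique , L⊆ with X⊆Z (∩ˡ r∈)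
            ...     | r∈S , r∈u , r∈z = r , L , r∈S , r∈u , r∈z , ∩ʳ r∈ , trans len-L len-ls , clique
                        , All.map (λ ((a , b , c) , d) → a , b , c , d) L⊆

          opaque
            -- If `y` misses all of `X i`, then part `i` is exhausted by the misses of `u`, `z` and
            -- `y`. What these three have left, with the at most `E i` misses of `k`, cannot cover
            -- the other parts, so one of them still offers a candidate for `r`.
            second-part : ¬ ∃ (_∈ Y i) → ∀ {k} → k ∈ X i → ∃₂ λ j r → j ∈ₗ ls × r ∈ Y j ∩ N k
            second-part none {k} k∈ with ∑-positive ls (λ l → ∣ Y l ∩ N k ∣) positive
              where
              s≤YN : ∀ l → s l ≤ ∣ Y l ∩ N k ∣ + μ k l + μ y l + (μ u l + μ z l)
              s≤YN l = ≤-trans (s≤X l) (+-monoˡ-≤ _ (≤-trans (drop-N {y} (X l) l X⊆P)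
                (+-monoˡ-≤ _ (drop-N {k} (Y l) l (λ x∈ → X⊆P (∩ˡ x∈))))))
              sum≤ : ∑ ls s ≤ ∑ ls (λ l → ∣ Y l ∩ N k ∣) + ∑ ls (μ k) + ∑ ls (μ y) + (∑ ls (μ u) + ∑ ls (μ z))
              sum≤ = ≤-trans (∑-mono ls λ l _ → s≤YN l) (≤-reflexive
                (trans (∑-+ ls _ _) (cong₂ _+_ (trans (∑-+ ls _ _) (cong (_+ _) (∑-+ ls _ _))) (∑-+ ls _ _))))
              sᵢ≤ : s i ≤ μ y i + (μ u i + μ z i)
              sᵢ≤ = ≤-trans (s≤X i) (+-monoˡ-≤ _ (≤-trans (drop-N {y} (X i) i X⊆P)
                (+-monoˡ-≤ _ (≮⇒≥ λ pos → none (card-positive (Y i) pos)))))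
              μk : ∑ ls (μ k) ≤ E i
              μk = ≤-trans (m≤n+m _ _) (μ-rest (↭-trans perm (↭-trans (prep i₀ p) (swap i₀ i ↭-refl))) (X⊆P k∈))
              total : (2 + b) * D < s i₀ + (s i + ∑ ls s)
              total = subst (_ <_) (trans (sym (card-parts₀ S c)) (∑-↭ s (↭-trans perm (prep i₀ p)))) S-big
              positive : 0 < ∑ ls (λ l → ∣ Y l ∩ N k ∣)
              positive = linear
                (D ∷ b * D ∷ s i₀ ∷ s i ∷ ∑ ls s ∷ E i₀ ∷ E i ∷ ∑ ls E ∷ β ∷ ∑ ls (λ l → ∣ Y l ∩ N k ∣)
                  ∷ ∑ ls (μ k) ∷ ∑ ls (μ y) ∷ ∑ ls (μ u) ∷ ∑ ls (μ z) ∷ μ y i ∷ μ u i ∷ μ z i ∷ [])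
                (λ { (d ∷ bd ∷ s₀ ∷ sᵢ ∷ σ ∷ e₀ ∷ e ∷ t ∷ β ∷ q ∷ k ∷ y ∷ u ∷ z ∷ yᵢ ∷ uᵢ ∷ zᵢ ∷ []) →
                  (con 1 ⊞ (d ⊞ (d ⊞ bd)) ≼ s₀ ⊞ (sᵢ ⊞ σ)) ∷ (σ ≼ q ⊞ k ⊞ y ⊞ (u ⊞ z)) ∷ (sᵢ ≼ yᵢ ⊞ (uᵢ ⊞ zᵢ))
                  ∷ (s₀ ⊞ e₀ ≼ d) ∷ (k ≼ e) ∷ (uᵢ ⊞ u ≼ e₀) ∷ (zᵢ ⊞ z ≼ β) ∷ (yᵢ ⊞ y ≼ β)
                  ∷ (con 1 ⊞ (e₀ ⊞ (e ⊞ t)) ≼ d) ∷ (β ≼ t) ∷ (β ≼ e₀) ∷ [] ⊢ con 1 ≼ q })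
                (total , sum≤ , sᵢ≤ , ≤-reflexive (s+E i₀) , μk , μu , μA z∈A , μA y∈A , E-total′ , β≤ls , β≤E i₀)
            ... | j , j∈ , pos with card-positive _ pos
            ...   | r , r∈ = j , r , j∈ , r∈

          opaque
            -- The roles change: part `j` supplies `r`, while `k` represents part `i` in the clique
            -- and need not see `y`.
            from-second : ∀ {k j r} → k ∈ X i → j ∈ₗ ls → r ∈ Y j ∩ N k → Transversal
            from-second {k} {j} {r} k∈ j∈ r∈ with bring-to-front j∈
            ... | ms , q with Unique-resp-↭ (prep i₀ (prep i q)) uniq
            ...   | _ ∷ i∉ ∷ j∉ ∷ uniq-ms
                  with greedy P (λ l → (X l ∩ N k) ∩ N r) E {λ x → (Z x × x ∈ N r) × x ∈ N k} ms uniq-ms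
                    (λ l x∈ → X⊆P (∩ˡ (∩ˡ x∈))) (λ l x∈ → (X⊆Z (∩ˡ (∩ˡ x∈)) , ∩ʳ x∈) , ∩ʳ (∩ˡ x∈)) μ-cross room
              where
              room : ∀ {l} → l ∈ₗ ms → ∑ ms E < ∣ (X l ∩ N k) ∩ N r ∣ + E l
              room {l} l∈ = linear
                (E i ∷ E j ∷ ∑ ms E ∷ E l ∷ ∣ X l ∣ ∷ ∣ X l ∩ N k ∣ ∷ ∣ (X l ∩ N k) ∩ N r ∣ ∷ μ k l ∷ μ r l ∷ [])
                (λ { (e ∷ e′ ∷ t ∷ f ∷ x ∷ x′ ∷ x″ ∷ m ∷ m′ ∷ []) →
                  (con 1 ⊞ (e ⊞ (e′ ⊞ t)) ≼ x ⊞ f) ∷ (x ≼ x′ ⊞ m) ∷ (x′ ≼ x″ ⊞ m′) ∷ (m ≼ e) ∷ (m′ ≼ e′) ∷ []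
                  ⊢ con 1 ⊞ t ≼ x″ ⊞ f })
                (subst (_< _) (trans ΣE≡ (cong (E i +_) (∑-↭ E q))) (loose (∈-resp-↭ (↭-sym q) (there l∈)))
                , drop-N (X l) l X⊆P , drop-N (X l ∩ N k) l (λ x∈ → X⊆P (∩ˡ x∈))
                , μ-cross (λ l≡i → All.lookup i∉ (there l∈) (sym l≡i)) (X⊆P k∈)
                , μ-cross (λ l≡j → All.lookup j∉ l∈ (sym l≡j)) (X⊆P (∩ˡ (∩ˡ r∈))))
            ...     | L , len-L , clique , L⊆ with X⊆Z k∈ | X⊆Z (∩ˡ (∩ˡ r∈))
            ...       | k∈S , k∈u , k∈z | r∈S , r∈u , r∈z =
                          r , k ∷ L , r∈S , r∈u , r∈z , ∩ʳ (∩ˡ r∈)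
                          , cong suc (trans len-L (cong pred (trans (sym (↭-length q)) len-ls)))
                          , All.map proj₂ L⊆ ∷ clique
                          , (k∈S , k∈u , k∈z , N-sym (∩ʳ r∈))
                            ∷ All.map (λ (((a , b , c) , d) , _) → a , b , c , d) L⊆

          opaque
            build : Transversal
            build with any? (_∈? Y i)
            ... | yes (r , r∈) = from-first r∈
            ... | no none with first-nonempty
            ...   | k , k∈ with second-part none k∈
            ...     | j , r , j∈ , r∈ = from-second k∈ j∈ r∈

    opaque
      transversal : Transversal
      transversal with colours-from i₀
      ... | ks , perm , len with Choose.first-part perm len
      ...   | i , ls , p , loose = Choose.build perm len p loose

-- Removing largest independent sets

module Peeling {n : ℕ} (G : Graph n) (D : ℕ) (missing : ∀ v → ∣ full ∖ adj G v ∣ ≤ D) where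

  open Colouring G
  open Dense G D missing
  open Transversal G D missing

  nbhd-card : ∀ b {U} w → (3 + b) * D < ∣ U ∣ → (2 + b) * D < ∣ U ∩ N w ∣
  nbhd-card b {U} w big = linear (D ∷ (2 + b) * D ∷ ∣ U ∣ ∷ ∣ U ∩ N w ∣ ∷ [])
    (λ { (d ∷ bd ∷ u ∷ s ∷ []) → (con 1 ⊞ (d ⊞ bd) ≼ u) ∷ (u ≼ s ⊞ d) ∷ [] ⊢ con 1 ⊞ bd ≼ s })
    (big , card-neighbours U w)

  one-class-room : ∀ b {S A : VSet n} → (2 + b) * D < ∣ S ∣ → Indep A → 2 * D + suc b * ∣ A ∣ < ∣ S ∣ + ∣ A ∣
  one-class-room b {S} {A} big ind = linear (D ∷ b * D ∷ ∣ S ∣ ∷ ∣ A ∣ ∷ b * ∣ A ∣ ∷ [])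
    (λ { (d ∷ bd ∷ s ∷ α ∷ bα ∷ []) → (con 1 ⊞ (d ⊞ (d ⊞ bd)) ≼ s) ∷ (bα ≼ bd) ∷ []
      ⊢ con 1 ⊞ (2 ⊠ d ⊞ (α ⊞ bα)) ≼ s ⊞ α })
    (big , *-monoʳ-≤ b (indep-card ind))

  module _ {b} {U A : VSet n} (big : (3 + b) * D < ∣ U ∣) (loc : LocallyCol (3 + b) U) (lrg : Largest U A) where

    private
      A⊆U : A ⊆ U
      A⊆U = proj₁ lrg

      indA : Indep A
      indA = proj₁ (proj₂ lrg)

      maxA : ∀ {w I} → I ⊆ U ∩ N w → Indep I → ∣ I ∣ ≤ ∣ A ∣
      maxA I⊆ = proj₂ (proj₂ lrg) λ v∈ → ∩ˡ (I⊆ v∈)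

    A-in-one-class : ∀ {w} {c : Fin n → Fin (3 + b)} → Proper (U ∩ N w) c →
      ∀ {x x′} → x ∈ A → x ∈ U ∩ N w → x′ ∈ A → x′ ∈ U ∩ N w → c x ≡ c x′
    A-in-one-class {w} p = one-class p indA maxA (one-class-room b (nbhd-card b w big) indA)

    opaque
      peel : LocallyCol (2 + b) (U ∖ A)
      peel {w} w∈ with loc (∖ˡ w∈) | largest-dominates lrg (∖ˡ w∈) (∖ʳ w∈)
      ... | c , proper | z , z∈A , zw = drop-class (c z) proper (λ v∈ → ∩⁺ (∖ˡ (∩ˡ v∈)) (∩ʳ v∈)) avoid
        where
        z∈S : z ∈ U ∩ N w
        z∈S = ∩⁺ (A⊆U z∈A) zw
        avoid : ∀ {u} → u ∈ (U ∖ A) ∩ N w → c u ≢ c z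
        avoid {u} u∈ cu≡cz with largest-dominates lrg (∖ˡ (∩ˡ u∈)) (∖ʳ (∩ˡ u∈))
        ... | y , y∈A , yu with transversal proper indA maxA (nbhd-card b w big)
                                  (λ x∈A x∈S → A-in-one-class proper x∈A x∈S z∈A z∈S)
                                  (∩⁺ (∖ˡ (∩ˡ u∈)) (∩ʳ u∈)) cu≡cz z∈A z∈S y∈A
        ...   | r , L , r∈S , ru , rz , ry , len , clique , L⊆ with loc (∩ˡ r∈S)
        ...     | c′ , proper′ = proper′ u∈r y∈r yu (trans
                    (same-colour proper′ (cong suc len)
                      (All.map (λ (x∈ , _) → ∩ʳ x∈) L⊆ ∷ clique)
                      ((∩⁺ (∖ˡ w∈) (N-sym (∩ʳ r∈S)) , N-sym (∩ʳ u∈) , N-sym zw)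
                        ∷ All.map (λ (x∈ , xu , xz , xr) → ∩⁺ (∩ˡ x∈) xr , xu , xz) L⊆)
                      u∈r z∈r)
                    (A-in-one-class proper′ z∈A z∈r y∈A y∈r))
          where
          u∈r : u ∈ U ∩ N r
          u∈r = ∩⁺ (∖ˡ (∩ˡ u∈)) (N-sym ru)
          z∈r : z ∈ U ∩ N r
          z∈r = ∩⁺ (A⊆U z∈A) (N-sym rz)
          y∈r : y ∈ U ∩ N r
          y∈r = ∩⁺ (A⊆U y∈A) (N-sym ry)

  -- The bound (b + 1/7) D < |U| without denominators, bracketed so that `b * D` can be an atom of
  -- `linear`.
  Cond : ℕ → VSet n → Set
  Cond b U = 7 * (b * D) + D < 7 * ∣ U ∣

  cond-big : ∀ b {U} → Cond b U → b * D < ∣ U ∣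
  cond-big b {U} cond = ≰⇒> λ small → n≮0 (linear (b * D ∷ D ∷ ∣ U ∣ ∷ [])
    (λ { (bd ∷ d ∷ u ∷ []) → (con 1 ⊞ (7 ⊠ bd ⊞ d) ≼ 7 ⊠ u) ∷ (7 · u ≼ bd) ∷ [] ⊢ con 1 ≼ con 0 })
    (cond , small))

  module _ {U A A′ : VSet n} (cond : Cond 3 U) (loc : LocallyCol 3 U)
    (lrg : Largest U A) (lrg′ : Largest (U ∖ A) A′) where

    private
      W : VSet n
      W = U ∖ A

      big : 3 * D < ∣ U ∣
      big = cond-big 3 cond

      A⊆U : A ⊆ U
      A⊆U = proj₁ lrg

      indA : Indep A
      indA = proj₁ (proj₂ lrg)

      A′⊆W : A′ ⊆ W
      A′⊆W = proj₁ lrg′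

      A′⊆U : A′ ⊆ U
      A′⊆U x∈ = ∖ˡ (A′⊆W x∈)

      indA′ : Indep A′
      indA′ = proj₁ (proj₂ lrg′)

      A′≤A : ∣ A′ ∣ ≤ ∣ A ∣
      A′≤A = proj₂ (proj₂ lrg) A′⊆U indA′

      N⊆W : ∀ {z} → z ∈ A → U ∩ N z ⊆ W
      N⊆W z∈A x∈ = ∖⁺ (∩ˡ x∈) λ x∈A → indA z∈A x∈A (∩ʳ x∈)

      U≤ : ∣ U ∣ ≤ ∣ A ∣ + ∣ W ∣
      U≤ = ≤-trans (≤-reflexive (card-split U A)) (+-monoˡ-≤ _ (card-mono ∩ʳ))

      maxA′ : ∀ {z} → z ∈ A → ∀ {I} → I ⊆ U ∩ N z → Indep I → ∣ I ∣ ≤ ∣ A′ ∣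
      maxA′ z∈A I⊆ = proj₂ (proj₂ lrg′) λ x∈ → N⊆W z∈A (I⊆ x∈)

      A′-in-one-class : ∀ {z} → z ∈ A → {c : Fin n → Fin 3} → Proper (U ∩ N z) c →
        ∀ {x x′} → x ∈ A′ → x ∈ U ∩ N z → x′ ∈ A′ → x′ ∈ U ∩ N z → c x ≡ c x′
      A′-in-one-class {z} z∈A p = one-class p indA′ (maxA′ z∈A) (one-class-room 0 (nbhd-card 0 z big) indA′)

      -- Since `z ∈ A`, its neighbourhood in `U` avoids `A`. Every class is thus an independent
      -- subset of `W`, of size at most that of `A′`.
      others≤ : ∀ {z} → z ∈ A → {c : Fin n → Fin 3} → Proper (U ∩ N z) c →
        ∀ i → ∣ U ∩ N z ∣ ≤ ∣ part (U ∩ N z) c i ∣ + 2 * ∣ A′ ∣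
      others≤ {z} z∈A {c} p i with colours-from i
      ... | ks , perm , len = begin
        ∣ U ∩ N z ∣                                        ≡⟨ card-parts₀ (U ∩ N z) c ⟨
        ∑ (allFin 3) (λ i → ∣ P i ∣)                       ≡⟨ ∑-↭ (λ i → ∣ P i ∣) perm ⟩
        ∣ P i ∣ + ∑ ks (λ i → ∣ P i ∣)                     ≤⟨ +-monoʳ-≤ _ (∑-mono ks λ i _ → P-card i) ⟩
        ∣ P i ∣ + ∑ ks (λ _ → ∣ A′ ∣)                      ≡⟨ cong (∣ P i ∣ +_) (trans (∑-const ks _) (cong (_* ∣ A′ ∣) len)) ⟩
        ∣ P i ∣ + 2 * ∣ A′ ∣                               ∎
        where
        open ≤-Reasoning
        P : Fin 3 → VSet n
        P = part (U ∩ N z) c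
        P-card : ∀ i → ∣ P i ∣ ≤ ∣ A′ ∣
        P-card i = maxA′ z∈A part-⊆ (part-indep p)

      U≤₃ : ∀ {z} → z ∈ A → {c : Fin n → Fin 3} → Proper (U ∩ N z) c → ∣ U ∩ N z ∣ ≤ 3 * ∣ A′ ∣
      U≤₃ z∈A p = ≤-trans (others≤ z∈A p zero) (+-monoˡ-≤ _ (maxA′ z∈A part-⊆ (part-indep p)))

      opaque
        -- Domination by `A′` covers only `W`, so a count is needed. If `z` missed both `A` and
        -- `A′`, the smaller set `A′` would have size at most D/2, whereas three classes covering
        -- more than 2D vertices force more than 2D/3.
        A-meets : ∀ {z} → z ∈ A → ∃ λ x → x ∈ A′ × x ∈ N z
        A-meets {z} z∈A with any? (λ x → (x ∈? A′) ×-dec (x ∈? N z)) | loc (A⊆U z∈A)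
        ... | yes found | _     = found
        ... | no none | c , p = ⊥-elim (n≮0 (linear
          (D ∷ ∣ U ∣ ∷ ∣ U ∩ N z ∣ ∷ ∣ A ∣ ∷ ∣ A′ ∣ ∷ ∣ A′ ∖ N z ∣ ∷ [])
          (λ { (d ∷ u ∷ s ∷ α ∷ α′ ∷ m ∷ []) →
            (2 · con 1 ⊞ 3 ⊠ d ≼ u) ∷ (2 · u ≼ s ⊞ d) ∷ (2 · s ≼ 3 ⊠ α′)
            ∷ (3 · α ⊞ m ≼ d) ∷ (3 · α′ ≼ m) ∷ (3 · α′ ≼ α) ∷ [] ⊢ con 1 ≼ con 0 })
          ( big , (card-neighbours U z) , (U≤₃ z∈A p)
          , (missing-beyond (indA z∈A) λ x∈A x∈A′ → ∖ʳ (A′⊆W x∈A′) x∈A)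
          , (card-mono λ x∈ → ∖⁺ x∈ λ xz → none (_ , x∈ , xz))
          , A′≤A)))

      module _ {z x u y : Fin n} {c : Fin n → Fin 3} (z∈A : z ∈ A) (proper : Proper (U ∩ N z) c)
        (x∈A′ : x ∈ A′) (xz : x ∈ N z) (u∈W : u ∈ W) (uz : u ∈ N z) (cu≡cx : c u ≡ c x)
        (y∈A′ : y ∈ A′) (yu : y ∈ N u) where

        S : VSet n
        S = U ∩ N z

        x∈S : x ∈ S
        x∈S = ∩⁺ (A′⊆U x∈A′) xz

        u∈S : u ∈ S
        u∈S = ∩⁺ (∖ˡ u∈W) uz

        opaque
          -- The argument of `peel` with `A′` and `x` in place of `A` and `z`. As `r ∈ W`, the first
          -- peeling already gives `W ∩ N r` two colours, so the single vertex of `L` forces `u` and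
          -- `x` to agree there.
          close-sizes : 7 * ∣ A ∣ ≤ D + 7 * ∣ A′ ∣ → ⊥
          close-sizes close with transversal proper indA′ (maxA′ z∈A) (nbhd-card 0 z big)
                                   (λ v∈A′ v∈S → A′-in-one-class z∈A proper v∈A′ v∈S x∈A′ x∈S)
                                   u∈S cu≡cx x∈A′ x∈S y∈A′
          ... | r , L , r∈S , ru , rx , ry , len , clique , L⊆ with peel big loc lrg (N⊆W z∈A r∈S)
          ...   | c′ , proper′ = proper′ u∈r y∈r yu (trans
                    (same-colour proper′ len clique
                      (All.map (λ (v∈ , vu , vx , vr) → ∩⁺ (N⊆W z∈A v∈) vr , vu , vx) L⊆) u∈r x∈r)
                    (one-class proper′ indA′ (λ I⊆ → proj₂ (proj₂ lrg′) λ v∈ → ∩ˡ (I⊆ v∈)) room x∈A′ x∈r y∈A′ y∈r))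
            where
            u∈r : u ∈ W ∩ N r
            u∈r = ∩⁺ u∈W (N-sym ru)
            x∈r : x ∈ W ∩ N r
            x∈r = ∩⁺ (A′⊆W x∈A′) (N-sym rx)
            y∈r : y ∈ W ∩ N r
            y∈r = ∩⁺ (A′⊆W y∈A′) (N-sym ry)
            -- The left side is at least |U| - D - (|A| - |A′|), and the last difference is at most
            -- D/7, which is exactly the surplus in `cond`.
            room : 2 * D + 0 < ∣ W ∩ N r ∣ + ∣ A′ ∣
            room = ≰⇒> λ small → n≮0 (linear
              (D ∷ ∣ U ∣ ∷ ∣ A ∣ ∷ ∣ A′ ∣ ∷ ∣ W ∣ ∷ ∣ W ∩ N r ∣ ∷ [])
              (λ { (d ∷ u ∷ α ∷ α′ ∷ w ∷ s ∷ []) →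
                (con 1 ⊞ (7 ⊠ (3 ⊠ d) ⊞ d) ≼ 7 ⊠ u) ∷ (7 · u ≼ α ⊞ w) ∷ (7 · w ≼ s ⊞ d)
                ∷ (7 ⊠ α ≼ d ⊞ 7 ⊠ α′) ∷ (7 · s ⊞ α′ ≼ 2 ⊠ d ⊞ con 0) ∷ [] ⊢ con 1 ≼ con 0 })
              (cond , U≤ , (card-neighbours W r) , close , small))

        module _ (far : D + 7 * ∣ A′ ∣ < 7 * ∣ A ∣) where

          opaque
            -- Three classes of size at most |A′| cover more than (15/7) D vertices, so 7|A′| > 5D;
            -- `far` adds another D.
            A-large : 6 * D < 7 * ∣ A ∣
            A-large = ≰⇒> λ small → n≮0 (linear
              (D ∷ ∣ U ∣ ∷ ∣ A ∣ ∷ ∣ A′ ∣ ∷ ∣ S ∣ ∷ [])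
              (λ { (d ∷ u ∷ α ∷ α′ ∷ s ∷ []) →
                (con 1 ⊞ (7 ⊠ (3 ⊠ d) ⊞ d) ≼ 7 ⊠ u) ∷ (7 · u ≼ s ⊞ d) ∷ (7 · s ≼ 3 ⊠ α′)
                ∷ (3 · con 1 ⊞ (d ⊞ 7 ⊠ α′) ≼ 7 ⊠ α) ∷ (3 · 7 ⊠ α ≼ 6 ⊠ d) ∷ []
                ⊢ con 1 ≼ con 0 })
              (cond , (card-neighbours U z) , (U≤₃ z∈A proper)
              , far , small))

          opaque
            -- Both `x` and `y` miss `A′`, and `u` misses its class `P`, which avoids `A`. Together
            -- they miss at most 3D - 2|A′| - |P| < (6/7) D vertices of `A`, fewer than it has.
            common : ∃ (_∈ ((A ∩ N x) ∩ N u) ∩ N y)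
            common = card-positive _ (≰⇒> λ none → n≮0 (linear
              (D ∷ ∣ U ∣ ∷ ∣ A ∣ ∷ ∣ A′ ∣ ∷ ∣ S ∣ ∷ ∣ P ∣ ∷ ∣ A ∩ N x ∣ ∷ ∣ A ∖ N x ∣ ∷ ∣ (A ∩ N x) ∩ N u ∣
                ∷ ∣ (A ∩ N x) ∖ N u ∣ ∷ ∣ ((A ∩ N x) ∩ N u) ∩ N y ∣ ∷ ∣ ((A ∩ N x) ∩ N u) ∖ N y ∣ ∷ [])
              (λ { (d ∷ u ∷ α ∷ α′ ∷ s ∷ p ∷ a₁ ∷ m₁ ∷ a₂ ∷ m₂ ∷ a₃ ∷ m₃ ∷ []) →
                (con 1 ⊞ (7 ⊠ (3 ⊠ d) ⊞ d) ≼ 7 ⊠ u) ∷ (7 · u ≼ s ⊞ d) ∷ (7 · s ≼ p ⊞ 2 ⊠ α′)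
                ∷ (con 1 ⊞ 6 ⊠ d ≼ 7 ⊠ α)
                ∷ (7 · α ≼ a₁ ⊞ m₁) ∷ (7 · a₁ ≼ a₂ ⊞ m₂) ∷ (7 · a₂ ≼ a₃ ⊞ m₃) ∷ (7 · a₃ ≼ con 0)
                ∷ (7 · α′ ⊞ m₁ ≼ d) ∷ (7 · p ⊞ m₂ ≼ d) ∷ (7 · α′ ⊞ m₃ ≼ d) ∷ []
                ⊢ con 1 ≼ con 0 })
              ( cond , (card-neighbours U z) , (others≤ z∈A proper (c x)) , A-large
              , (≤-reflexive (card-split A (N x)))
              , (≤-reflexive (card-split (A ∩ N x) (N u)))
              , (≤-reflexive (card-split ((A ∩ N x) ∩ N u) (N y)))
              , none
              , (missing-beyond (indA′ x∈A′) λ v∈A′ v∈A → ∖ʳ (A′⊆W v∈A′) v∈A)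
              , (missing-beyond (part-indep proper (part⁺ u∈S cu≡cx))
                  λ v∈P v∈ → indA z∈A (∩ˡ v∈) (∩ʳ (part-⊆ v∈P)))
              , (missing-beyond (indA′ y∈A′) λ v∈A′ v∈ → ∖ʳ (A′⊆W v∈A′) (∩ˡ (∩ˡ v∈))))))
              where
              P : VSet n
              P = part S c (c x)

          opaque
            -- Choosing the transversal inside `N z*` lets `z*` replace `r` as the vertex whose
            -- neighbourhood is coloured. There `r ∷ L` forces `u` and `x` to agree, and `A′` lies
            -- in one class because `z* ∈ A`.
            far-sizes : ⊥
            far-sizes with common
            ... | z* , z*∈ with transversal {S = S*} (λ v∈ w∈ → proper (∩ˡ v∈) (∩ˡ w∈)) indA′
                                  (λ I⊆ → maxA′ z∈A λ v∈ → ∩ˡ (I⊆ v∈)) S*-big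
                                  (λ v∈A′ v∈S* → A′-in-one-class z∈A proper v∈A′ (∩ˡ v∈S*) x∈A′ x∈S)
                                  (∩⁺ u∈S (N-sym (∩ʳ (∩ˡ z*∈)))) cu≡cx x∈A′ (∩⁺ x∈S (N-sym (∩ʳ (∩ˡ (∩ˡ z*∈))))) y∈A′
              where
              z*∈A : z* ∈ A
              z*∈A = ∩ˡ (∩ˡ (∩ˡ z*∈))
              S* : VSet n
              S* = S ∩ N z*
              -- Both `z` and `z*` miss `A`, so each removes at most D - |A| from `W`. What remains
              -- is at least |U| + |A| - 2D, and 22/7 + 6/7 - 2 = 2.
              S*-big : 2 * D < ∣ S* ∣
              S*-big = ≰⇒> λ small → n≮0 (linear
                (D ∷ ∣ U ∣ ∷ ∣ A ∣ ∷ ∣ W ∣ ∷ ∣ W ∩ N z ∣ ∷ ∣ W ∖ N z ∣ ∷ ∣ (W ∩ N z) ∩ N z* ∣ ∷ ∣ (W ∩ N z) ∖ N z* ∣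
                  ∷ ∣ S* ∣ ∷ [])
                (λ { (d ∷ u ∷ α ∷ w ∷ w₁ ∷ m₁ ∷ w₂ ∷ m₂ ∷ s ∷ []) →
                  (con 1 ⊞ (7 ⊠ (3 ⊠ d) ⊞ d) ≼ 7 ⊠ u) ∷ (7 · u ≼ α ⊞ w) ∷ (con 1 ⊞ 6 ⊠ d ≼ 7 ⊠ α)
                  ∷ (7 · w ≼ w₁ ⊞ m₁) ∷ (7 · w₁ ≼ w₂ ⊞ m₂) ∷ (7 · w₂ ≼ s)
                  ∷ (7 · α ⊞ m₁ ≼ d) ∷ (7 · α ⊞ m₂ ≼ d) ∷ (7 · s ≼ 2 ⊠ d) ∷ []
                  ⊢ con 1 ≼ con 0 })
                ( cond , U≤ , A-large
                , (≤-reflexive (card-split W (N z)))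
                , (≤-reflexive (card-split (W ∩ N z) (N z*)))
                , (card-mono λ v∈ → ∩⁺ (∩⁺ (∖ˡ (∩ˡ (∩ˡ v∈))) (∩ʳ (∩ˡ v∈))) (∩ʳ v∈))
                , (missing-beyond (indA z∈A) λ v∈A v∈W → ∖ʳ v∈W v∈A)
                , (missing-beyond (indA z*∈A) λ v∈A v∈ → ∖ʳ (∩ˡ v∈) v∈A)
                , small))
            ...   | r , L , r∈S* , ru , rx , ry , len , clique , L⊆
                  with loc (A⊆U (∩ˡ (∩ˡ (∩ˡ z*∈))))
            ...     | c′ , proper′ = proper′ u∈* y∈* yu (trans
                        (same-colour proper′ (cong suc len)
                          (All.map (λ (_ , _ , _ , vr) → vr) L⊆ ∷ clique)
                          ((∩⁺ (∩ˡ (∩ˡ r∈S*)) (∩ʳ r∈S*) , ru , rx)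
                            ∷ All.map (λ (v∈ , vu , vx , _) → ∩⁺ (∩ˡ (∩ˡ v∈)) (∩ʳ v∈) , vu , vx) L⊆)
                          u∈* x∈*)
                        (A′-in-one-class (∩ˡ (∩ˡ (∩ˡ z*∈))) proper′ x∈A′ x∈* y∈A′ y∈*))
              where
              u∈* : u ∈ U ∩ N z*
              u∈* = ∩⁺ (∖ˡ u∈W) (N-sym (∩ʳ (∩ˡ z*∈)))
              x∈* : x ∈ U ∩ N z*
              x∈* = ∩⁺ (A′⊆U x∈A′) (N-sym (∩ʳ (∩ˡ (∩ˡ z*∈))))
              y∈* : y ∈ U ∩ N z*
              y∈* = ∩⁺ (A′⊆U y∈A′) (N-sym (∩ʳ z*∈))

    opaque
      peel-twice : ∀ {z} → z ∈ A → Col 2 ((W ∖ A′) ∩ N z)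
      peel-twice {z} z∈A with loc (A⊆U z∈A) | A-meets z∈A
      ... | c , proper | x , x∈A′ , xz = drop-class (c x) proper (λ v∈ → ∩⁺ (∖ˡ (∖ˡ (∩ˡ v∈))) (∩ʳ v∈)) avoid
        where
        avoid : ∀ {u} → u ∈ (W ∖ A′) ∩ N z → c u ≢ c x
        avoid u∈ cu≡cx with largest-dominates lrg′ (∖ˡ (∩ˡ u∈)) (∖ʳ (∩ˡ u∈)) | 7 * ∣ A ∣ ≤? D + 7 * ∣ A′ ∣
        ... | y , y∈A′ , yu | yes close =
          close-sizes z∈A proper x∈A′ xz (∖ˡ (∩ˡ u∈)) (∩ʳ u∈) cu≡cx y∈A′ yu close
        ... | y , y∈A′ , yu | no ¬close =
          far-sizes z∈A proper x∈A′ xz (∖ˡ (∩ˡ u∈)) (∩ʳ u∈) cu≡cx y∈A′ yu (≰⇒> ¬close)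

-- Bipartiteness via odd closed walks

odd : ℕ → Bool
odd zero    = false
odd (suc k) = not (odd k)

odd-+ : ∀ j k → odd (j + k) ≡ odd j xor odd k
odd-+ zero    k = refl
odd-+ (suc j) k = trans (cong not (odd-+ j k)) (Bool.not-distribˡ-xor (odd j) (odd k))

¬¬-∀ : ∀ {m} {P : Fin m → Set} → (∀ i → ¬ ¬ P i) → ¬ ¬ (∀ i → P i)
¬¬-∀ {zero}  h k = k λ ()
¬¬-∀ {suc m} h k = h zero λ p₀ → ¬¬-∀ (λ i → h (suc i)) λ p → k λ { zero → p₀ ; (suc i) → p i }

bit : Fin 2 → Bool
bit zero       = false
bit (suc zero) = true

bit-≢ : ∀ {i j} → i ≢ j → bit i ≡ not (bit j)
bit-≢ {zero}     {zero}     h = ⊥-elim (h refl)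
bit-≢ {zero}     {suc zero} h = refl
bit-≢ {suc zero} {zero}     h = refl
bit-≢ {suc zero} {suc zero} h = ⊥-elim (h refl)

module Bipartite {n : ℕ} (G : Graph n) (D : ℕ) (missing : ∀ v → ∣ full ∖ adj G v ∣ ≤ D) (W : VSet n) where

  open Colouring G
  open Dense G D missing

  data Walk : Fin n → Fin n → ℕ → Set where
    stop : ∀ {u} → u ∈ W → Walk u u 0
    step : ∀ {u v w k} → u ∈ W → v ∈ N u → Walk v w k → Walk u w (suc k)

  start∈ : ∀ {u v k} → Walk u v k → u ∈ W
  start∈ (stop u∈)     = u∈
  start∈ (step u∈ _ _) = u∈

  join : ∀ {u v w j k} → Walk u v j → Walk v w k → Walk u w (j + k)
  join (stop _)       q = q
  join (step u∈ uv p) q = step u∈ uv (join p q)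

  snoc : ∀ {u v w k} → Walk u v k → v ∈ W → w ∈ W → w ∈ N v → Walk u w (suc k)
  snoc (stop _)       v∈ w∈ vw = step v∈ vw (stop w∈)
  snoc (step u∈ uv p) v∈ w∈ vw = step u∈ uv (snoc p v∈ w∈ vw)

  end∈ : ∀ {u v k} → Walk u v k → v ∈ W
  end∈ (stop u∈)    = u∈
  end∈ (step _ _ p) = end∈ p

  reverse : ∀ {u v k} → Walk u v k → Walk v u k
  reverse (stop u∈)      = stop u∈
  reverse (step u∈ uv p) = snoc (reverse p) (start∈ p) u∈ (N-sym uv)

  NoOddBelow : ℕ → Set
  NoOddBelow L = ∀ {k} → k < L → ∀ {u} → Walk u u k → odd k ≡ true → ⊥

  -- The end point is not counted.
  hits : ∀ {u v k} → Fin n → Walk u v k → ℕ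
  hits x (stop _)           = 0
  hits x (step {u = u} _ _ p) = χ (N u x) + hits x p

  hits≤ : ∀ {u v k} x (p : Walk u v k) → hits x p ≤ k
  hits≤ x (stop _) = z≤n
  hits≤ x (step {u = u} _ _ p) with N u x
  ... | true  = s≤s (hits≤ x p)
  ... | false = m≤n⇒m≤1+n (hits≤ x p)

  -- The bound `k ≤ hits x p` says that `x` sees every counted vertex, so the colours of `N x`
  -- alternate along the walk.
  colour-parity : ∀ {x c} → Proper (W ∩ N x) c → ∀ {u v k} (p : Walk u v k) → k ≤ hits x p → v ∈ N x →
    u ∈ N x × bit (c u) ≡ odd k xor bit (c v)
  colour-parity proper (stop _) _ vx = vx , refl
  colour-parity {x} proper (step {u = u} {k = k} u∈ uv p) all vx with N u x in eq
  ... | false = ⊥-elim (<-irrefl refl (≤-trans all (hits≤ x p)))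
  ... | true with colour-parity proper p (≤-pred all) vx
  ...   | v∈x , parity = N-sym (mem eq) ,
            trans (bit-≢ (proper (∩⁺ u∈ (N-sym (mem eq))) (∩⁺ (start∈ p) v∈x) uv))
              (trans (cong not parity) (Bool.not-distribˡ-xor (odd k) _))

  -- Alternation around a fully seen odd closed walk would make the colour of the start differ from
  -- itself.
  hits-odd : ∀ {x u k} → Col 2 (W ∩ N x) → (p : Walk u u k) → odd k ≡ true → hits x p < k
  hits-odd {x} (c , proper) (step {u = u} {k = k} u∈ uv p) od = ≰⇒> all-hit
    where
    all-hit : ¬ suc k ≤ hits x (step u∈ uv p)
    all-hit all with colour-parity proper (step u∈ uv p) all (u∈Nx all)
      where
      u∈Nx : suc k ≤ χ (N u x) + hits x p → u ∈ N x
      u∈Nx all with N u x in eq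
      ... | true  = N-sym (mem eq)
      ... | false = ⊥-elim (<-irrefl refl (≤-trans all (hits≤ x p)))
    ... | _ , parity = Bool.not-¬ {bit (c u)} refl (trans parity (cong (_xor bit (c u)) od))

  -- A walk cut at its first vertex `a` seen by `x`; the step leaving `a` is kept apart so that
  -- successive cuts give arcs of positive length.
  record Hit (x u v : Fin n) (m L : ℕ) : Set where
    constructor hit
    field
      {a b}     : Fin n
      {j k}     : ℕ
      a∈x       : a ∈ N x
      before    : Walk u a j
      ab        : b ∈ N a
      after     : Walk b v k
      remaining : m ≤ hits x after
      lengths   : j + suc k ≡ L

  next-hit : ∀ {x u v L m} (p : Walk u v L) → m < hits x p → Hit x u v m L
  next-hit {x} (step {u = u} u∈ uv p) h with N u x in eq
  ... | true  = hit (N-sym (mem eq)) (stop u∈) uv p (≤-pred h) refl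
  ... | false with next-hit p h
  ...   | hit a∈ before ab after rem len = hit a∈ (step u∈ uv before) ab after rem (cong suc len)

  odd-summand : ∀ q r t → odd (q + (r + t)) ≡ true → odd q ≡ true ⊎ odd r ≡ true ⊎ odd t ≡ true
  odd-summand q r t h rewrite odd-+ q (r + t) | odd-+ r t with odd q | odd r | odd t
  ... | true  | _     | _    = inj₁ refl
  ... | false | true  | _    = inj₂ (inj₁ refl)
  ... | false | false | true = inj₂ (inj₂ refl)

  module _ {x : Fin n} (x∈ : x ∈ W) (col : Col 2 (W ∩ N x)) where

    detour : ∀ {a b q} → a ∈ N x → b ∈ N x → Walk a b q → Walk x x (2 + q)
    detour ax bx p = step x∈ ax (snoc p (end∈ p) x∈ (N-sym bx))

    edge : ∀ {a b} → Walk a b 1 → b ∈ N a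
    edge (step _ ab (stop _)) = ab

    no-triangle : ∀ {a b c} → a ∈ N x → b ∈ N x → c ∈ N x → Walk a b 1 → Walk b c 1 → Walk c a 1 → ⊥
    no-triangle {a} {b} {c} ax bx cx ab bc ca = Bool.not-¬ {bit (f a)} refl (begin
      bit (f a)               ≡⟨ flip ax bx ab ⟩
      not (bit (f b))         ≡⟨ cong not (flip bx cx bc) ⟩
      not (not (bit (f c)))   ≡⟨ cong (not ∘ not) (flip cx ax ca) ⟩
      not (not (not (bit (f a))))  ≡⟨ Bool.not-involutive _ ⟩
      not (bit (f a))         ∎)
      where
      open ≡-Reasoning
      f : Fin n → Fin 2
      f = proj₁ col
      flip : ∀ {u v} → u ∈ N x → v ∈ N x → Walk u v 1 → bit (f u) ≡ not (bit (f v))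
      flip ux vx p = bit-≢ (proj₂ col (∩⁺ (start∈ p) ux) (∩⁺ (end∈ p) vx) (edge p))

    -- Replacing the other two arcs by a detour through x shortens the odd closed walk.
    odd-arc : ∀ {a b c q r t} → NoOddBelow (suc q + (suc r + suc t)) → odd (suc q) ≡ true →
      a ∈ N x → b ∈ N x → c ∈ N x → Walk a b (suc q) → Walk b c (suc r) → Walk c a (suc t) → ⊥
    odd-arc {q = zero} {zero} {zero} below od ax bx cx p p′ p″ = no-triangle ax bx cx p p′ p″
    -- Here a detour over the first arc need not be shorter; instead the edge from `b` to `c` forms
    -- a triangle with `x`, shorter than the whole walk.
    odd-arc {q = suc q} {zero} {zero} below od ax bx cx p p′ p″ =
      below (s≤s (s≤s (≤-trans (s≤s (s≤s z≤n)) (m≤n+m 2 q)))) (detour bx cx p′) refl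
    odd-arc {q = q} {suc r} {t} below od ax bx cx p p′ p″ =
      below (linear (q ∷ r ∷ t ∷ []) (λ { (q ∷ r ∷ t ∷ []) →
        [] ⊢ con 1 ⊞ (con 3 ⊞ q) ≼ con 1 ⊞ q ⊞ ((con 2 ⊞ r) ⊞ (con 1 ⊞ t)) }) _)
        (detour ax bx p) (trans (Bool.not-involutive _) od)
    odd-arc {q = q} {zero} {suc t} below od ax bx cx p p′ p″ =
      below (linear (q ∷ t ∷ []) (λ { (q ∷ t ∷ []) →
        [] ⊢ con 1 ⊞ (con 3 ⊞ q) ≼ con 1 ⊞ q ⊞ (con 1 ⊞ (con 2 ⊞ t)) }) _)
        (detour ax bx p) (trans (Bool.not-involutive _) od)

    three-arcs : ∀ {a b c q r t} → NoOddBelow (suc q + (suc r + suc t)) →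
      odd (suc q + (suc r + suc t)) ≡ true →
      a ∈ N x → b ∈ N x → c ∈ N x → Walk a b (suc q) → Walk b c (suc r) → Walk c a (suc t) → ⊥
    three-arcs {q = q} {r} {t} below od ax bx cx p p′ p″ with odd-summand (suc q) (suc r) (suc t) od
    ... | inj₁ h        = odd-arc below h ax bx cx p p′ p″
    ... | inj₂ (inj₁ h) = odd-arc (subst NoOddBelow (rotate (suc q) (suc r) (suc t)) below) h bx cx ax p′ p″ p
      where
      rotate : ∀ i j k → i + (j + k) ≡ j + (k + i)
      rotate i j k = trans (+-comm i (j + k)) (+-assoc j k i)
    ... | inj₂ (inj₂ h) = odd-arc (subst NoOddBelow (rotate (suc q) (suc r) (suc t)) below) h cx ax bx p″ p p′
      where
      rotate : ∀ i j k → i + (j + k) ≡ k + (i + j)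
      rotate i j k = trans (sym (+-assoc i j k)) (+-comm (i + j) k)

    -- Three hits cut the walk into three arcs, one of them odd, and `odd-arc` then contradicts
    -- minimality or the bipartiteness of `N x`.
    hits≤2 : ∀ {u L} → NoOddBelow L → odd L ≡ true → (p : Walk u u L) → hits x p ≤ 2
    hits≤2 {L = L} below od p = ≮⇒≥ λ many → contra many
      where
      contra : 2 < hits x p → ⊥
      contra many with next-hit p many
      ... | hit {j = j} ax before ab p₁ h₁ refl with next-hit p₁ h₁
      ...   | hit {j = j₁} bx before₁ bc p₂ h₂ refl with next-hit p₂ h₂
      ...     | hit {j = j₂} {k} cx before₂ cd p₃ _ refl =
                  three-arcs (subst NoOddBelow len below) (trans (cong odd (sym len)) od) ax bx cx
                    (step (end∈ before) ab before₁) (step (end∈ before₁) bc before₂)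
                    -- The third arc passes through the base point of the closed walk.
                    (join (step (end∈ before₂) cd p₃) before)
        where
        len : j + suc (j₁ + suc (j₂ + suc k)) ≡ suc j₁ + (suc j₂ + suc (k + j))
        len = ≤-antisym
          (linear (j ∷ j₁ ∷ j₂ ∷ k ∷ []) (λ { (j ∷ j₁ ∷ j₂ ∷ k ∷ []) → [] ⊢
            j ⊞ (con 1 ⊞ (j₁ ⊞ (con 1 ⊞ (j₂ ⊞ (con 1 ⊞ k))))) ≼ con 1 ⊞ j₁ ⊞ (con 1 ⊞ j₂ ⊞ (con 1 ⊞ (k ⊞ j))) }) _)
          (linear (j ∷ j₁ ∷ j₂ ∷ k ∷ []) (λ { (j ∷ j₁ ∷ j₂ ∷ k ∷ []) → [] ⊢
            con 1 ⊞ j₁ ⊞ (con 1 ⊞ j₂ ⊞ (con 1 ⊞ (k ⊞ j))) ≼ j ⊞ (con 1 ⊞ (j₁ ⊞ (con 1 ⊞ (j₂ ⊞ (con 1 ⊞ k))))) }) _)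

  -- Double counting: each counted vertex of the walk sees all but at most `D` vertices of `U`.
  hits-total : ∀ (U : VSet n) {u v k} (p : Walk u v k) →
    k * ∣ U ∣ ≤ k * D + ∑ (allFin n) (λ x → χ (U x) * hits x p)
  hits-total U (stop _) = z≤n
  hits-total U (step {u = u} {k = k} _ _ p) = linear
    (∣ U ∣ ∷ k * ∣ U ∣ ∷ D ∷ k * D ∷ ∣ U ∩ N u ∣ ∷ ∑ (allFin n) (λ x → χ (U x) * hits x p)
      ∷ ∑ (allFin n) (λ x → χ (U x) * (χ (N u x) + hits x p)) ∷ [])
    (λ { (υ ∷ kυ ∷ d ∷ kd ∷ s ∷ h ∷ h′ ∷ []) →
      (υ ≼ s ⊞ d) ∷ (kυ ≼ kd ⊞ h) ∷ (s ⊞ h ≼ h′) ∷ [] ⊢ υ ⊞ kυ ≼ (d ⊞ kd) ⊞ h′ })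
    (card-neighbours U u , hits-total U p , ≤-reflexive (begin
      ∣ U ∩ N u ∣ + ∑ (allFin n) (λ x → χ (U x) * hits x p)
        ≡⟨ cong (_+ _) (card-∩ U (N u)) ⟩
      ∑ (allFin n) (λ x → χ (U x) * χ (N u x)) + ∑ (allFin n) (λ x → χ (U x) * hits x p)
        ≡⟨ ∑-+ (allFin n) _ _ ⟨
      ∑ (allFin n) (λ x → χ (U x) * χ (N u x) + χ (U x) * hits x p)
        ≡⟨ ∑-cong (allFin n) (λ x → sym (*-distribˡ-+ (χ (U x)) (χ (N u x)) (hits x p))) ⟩
      ∑ (allFin n) (λ x → χ (U x) * (χ (N u x) + hits x p))
        ∎))
    where open ≡-Reasoning

  module _ {U : VSet n} (W⊆U : W ⊆ U) (big : 3 * D < ∣ U ∣) (rest : ∣ U ∖ W ∣ ≤ 2 * D)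
    (col : ∀ {x} → x ∈ U → Col 2 (W ∩ N x)) where

    -- A vertex of `W` sees at most two positions of a shortest odd closed walk; any other vertex of
    -- `U` misses at least one.
    hits-weighted : ∀ {u L} → NoOddBelow (suc L) → odd (suc L) ≡ true → (p : Walk u u (suc L)) →
      ∑ (allFin n) (λ x → χ (U x) * hits x p) ≤ 2 * ∣ W ∣ + L * ∣ U ∖ W ∣
    hits-weighted {L = L} below od p = begin
      ∑ (allFin n) (λ x → χ (U x) * hits x p)                              ≤⟨ ∑-mono (allFin n) (λ x _ → pointwise x) ⟩
      ∑ (allFin n) (λ x → 2 * χ (W x) + L * χ ((U ∖ W) x))                 ≡⟨ ∑-+ (allFin n) _ _ ⟩
      ∑ (allFin n) (λ x → 2 * χ (W x)) + ∑ (allFin n) (λ x → L * χ ((U ∖ W) x))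
        ≡⟨ cong₂ _+_ (trans (∑-* (allFin n) 2 _) (cong (2 *_) (sym (card-def W))))
                     (trans (∑-* (allFin n) L _) (cong (L *_) (sym (card-def (U ∖ W))))) ⟩
      2 * ∣ W ∣ + L * ∣ U ∖ W ∣                                            ∎
      where
      open ≤-Reasoning
      pointwise : ∀ x → χ (U x) * hits x p ≤ 2 * χ (W x) + L * χ ((U ∖ W) x)
      pointwise x with x ∈? U | x ∈? W
      ... | no x∉U  | _        rewrite ∉⇒false x∉U = z≤n
      ... | yes x∈U | yes x∈W  rewrite holds x∈U | holds x∈W =
        ≤-trans (≤-reflexive (*-identityˡ _)) (≤-trans (hits≤2 x∈W (col x∈U) below od p) (m≤m+n 2 _))
      ... | yes x∈U | no x∉W   rewrite holds x∈U | holds (∖⁺ x∈U x∉W) =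
        ≤-trans (≤-reflexive (*-identityˡ _)) (≤-trans (≤-pred (hits-odd (col x∈U) p od))
          (≤-trans (≤-reflexive (sym (*-identityʳ L))) (m≤n+m _ _)))

    -- For a shortest such walk the two counts give L(|U| - D) ≤ 2|W| + (L - 1)|U ∖ W|, that is, |U|
    -- + (L - 3)|W| ≤ L D. This contradicts |U| > 3D and |W| ≥ D.
    no-odd-closed : ∀ L {u} → Walk u u L → odd L ≡ true → ⊥
    no-odd-closed = <-rec _ shorter
      where
      shorter : ∀ L → (∀ {k} → k < L → ∀ {u} → Walk u u k → odd k ≡ true → ⊥) →
        ∀ {u} → Walk u u L → odd L ≡ true → ⊥
      shorter (suc zero) _ (step u∈ uu (stop _)) _ = N-irrefl uu
      shorter (suc (suc (suc l))) below p od = n≮0 (linear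
        (D ∷ l * D ∷ ∣ U ∣ ∷ l * ∣ U ∣ ∷ ∣ W ∣ ∷ l * ∣ W ∣ ∷ ∣ U ∖ W ∣ ∷ l * ∣ U ∖ W ∣
          ∷ ∑ (allFin n) (λ x → χ (U x) * hits x p) ∷ [])
        (λ { (d ∷ ld ∷ u ∷ lu ∷ w ∷ lw ∷ r ∷ lr ∷ h ∷ []) →
          (u ⊞ (u ⊞ (u ⊞ lu)) ≼ (d ⊞ (d ⊞ (d ⊞ ld))) ⊞ h) ∷ (h ≼ 2 ⊠ w ⊞ (r ⊞ (r ⊞ lr)))
          ∷ (con 1 ⊞ 3 ⊠ d ≼ u) ∷ (2 · w ⊞ r ≼ u) ∷ (lw ⊞ lr ≼ lu) ∷ (ld ≼ lw) ∷ [] ⊢ con 1 ≼ con 0 })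
        ( hits-total U p , hits-weighted below od p , big , ≤-reflexive (sym split)
        , ≤-reflexive (trans (sym (*-distribˡ-+ l ∣ W ∣ _)) (cong (l *_) (sym split)))
        , *-monoʳ-≤ l D≤W))
        where
        split : ∣ U ∣ ≡ ∣ W ∣ + ∣ U ∖ W ∣
        split = trans (card-split U W)
          (cong (_+ ∣ U ∖ W ∣) (≤-antisym (card-mono ∩ʳ) (card-mono λ x∈ → ∩⁺ (W⊆U x∈) x∈)))
        D≤W : D ≤ ∣ W ∣
        D≤W = linear (D ∷ ∣ U ∣ ∷ ∣ W ∣ ∷ ∣ U ∖ W ∣ ∷ [])
          (λ { (d ∷ u ∷ w ∷ r ∷ []) →
            (con 1 ⊞ 3 ⊠ d ≼ u) ∷ (r ≼ 2 ⊠ d) ∷ (u ≼ w ⊞ r) ∷ [] ⊢ d ≼ w })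
          (big , rest , ≤-reflexive split)

    Joined : Bool → Fin n → Fin n → Set
    Joined b u v = ∃ λ k → Walk u v k × odd k ≡ b

    joined-step : ∀ {b u v w} → w ∈ W → w ∈ N v → Joined b u v → Joined (not b) u w
    joined-step w∈ vw (k , p , refl) = suc k , snoc p (end∈ p) w∈ vw , refl

    joined-unique : ∀ {u v} → Joined false u v → Joined true u v → ⊥
    joined-unique (k , p , ev) (l , q , od) = no-odd-closed (k + l) (join p (reverse q))
      (trans (odd-+ k l) (cong₂ _xor_ ev od))

    module _ (dec : ∀ b u v → Dec (Joined b u v)) where

      -- Colour by the parity of a walk from the first vertex of the component.
      side : List (Fin n) → Fin n → Bool
      side []       v = false
      side (r ∷ rs) v with dec false r v | dec true r v
      ... | yes _ | _     = false
      ... | no _  | yes _ = true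
      ... | no _  | no _  = side rs v

      side-proper : ∀ rs {u v} → u ∈ₗ rs → u ∈ W → v ∈ W → v ∈ N u → side rs u ≢ side rs v
      side-proper (r ∷ rs) {u} {v} u∈rs u∈ v∈ uv with dec false r u | dec true r u | dec false r v | dec true r v
      ... | yes e | _     | yes e′ | _      = λ _ → joined-unique e′ (joined-step v∈ uv e)
      ... | yes e | _     | no _   | yes _  = λ ()
      ... | yes e | _     | no _   | no o′  = λ _ → o′ (joined-step v∈ uv e)
      ... | no _  | yes o | yes _  | _      = λ ()
      ... | no _  | yes o | no e′  | _      = λ _ → e′ (joined-step v∈ uv o)
      ... | no _  | no o  | yes e′ | _      = λ _ → o (joined-step u∈ (N-sym uv) e′)
      ... | no e  | no _  | no _   | yes o′ = λ _ → e (joined-step u∈ (N-sym uv) o′)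
      ... | no e  | no _  | no _   | no _ with u∈rs
      ...   | here refl   = λ _ → e (0 , stop u∈ , refl)
      ...   | there u∈rs′ = side-proper rs u∈rs′ u∈ v∈ uv

    TwoSided : Subset n → Set
    TwoSided s = ∀ u v → u ∈ W → v ∈ W → v ∈ N u → Vec.lookup s u ≢ Vec.lookup s v

    two-sided? : Dec (∃ TwoSided)
    two-sided? = anySubset? λ s → all? λ u → all? λ v →
      (u ∈? W) →-dec ((v ∈? W) →-dec ((v ∈? N u) →-dec ¬? (Vec.lookup s u Bool.≟ Vec.lookup s v)))

    opaque
      -- Existence of a walk of given parity is not shown decidable. A two-colouring can be searched
      -- for, however, so it is enough to refute its absence, and under that double negation
      -- decidability for all pairs may be assumed.
      bipartite : Col 2 W
      bipartite with two-sided?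
      ... | yes (s , proper) = colour ∘ Vec.lookup s , λ {u} {v} u∈ v∈ uv eq → proper u v u∈ v∈ uv (colour-inj eq)
        where
        colour : Bool → Fin 2
        colour false = zero
        colour true  = suc zero
        colour-inj : ∀ {a b} → colour a ≡ colour b → a ≡ b
        colour-inj {false} {false} _ = refl
        colour-inj {true}  {true}  _ = refl
      ... | no none = ⊥-elim (¬¬-∀ (λ u → ¬¬-∀ λ v → both u v) λ dec →
        let d = λ { false u v → proj₁ (dec u v) ; true u v → proj₂ (dec u v) }
            s = Vec.tabulate (side d (allFin n))
        in none (s , λ u v u∈ v∈ uv eq → side-proper d (allFin n) (∈-allFin u) u∈ v∈ uv
             (trans (sym (lookup∘tabulate _ u)) (trans eq (lookup∘tabulate _ v)))))
        where
        both : ∀ u v → ¬ ¬ (Dec (Joined false u v) × Dec (Joined true u v))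
        both u v k = ¬¬-excluded-middle λ e → ¬¬-excluded-middle λ o → k (e , o)

-- The degree condition

module _ where

  open import Data.Integer using (+_; -[1+_])

  -- Unnormalised rationals have explicit numerators, with no gcd in the way of the
  -- cross-multiplication below.
  threshold-ᵘ : ∀ m k → ℚ.toℚᵘ (threshold m ℚ.* toℚ k) ≃ (mkℚᵘ (+ 1) 0 ℚᵘ.- mkℚᵘ (+ 7) (7 * m)) ℚᵘ.* mkℚᵘ (+ k) 0
  threshold-ᵘ m k = ℚᵘ.≃-trans (ℚ.toℚᵘ-homo-* (threshold m) (toℚ k)) (ℚᵘ.*-cong
    (ℚᵘ.≃-trans (ℚ.toℚᵘ-homo-+ ℚ.1ℚ (ℚ.- t)) (ℚᵘ.+-congʳ (mkℚᵘ (+ 1) 0)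
      (ℚᵘ.≃-trans (ℚ.toℚᵘ-homo‿- t) (ℚᵘ.-‿cong (ℚ.toℚᵘ-fromℚᵘ (mkℚᵘ (+ 7) (7 * m)))))))
    (ℚ.toℚᵘ-fromℚᵘ (mkℚᵘ (+ k) 0)))
    where
    t : ℚ.ℚ
    t = + 7 ℚ./ suc (7 * m)

  threshold-< : ∀ m n k → threshold m ℚ.* toℚ n ℚ.< toℚ k → suc (7 * m) * n < suc (7 * m) * k + 7 * n
  threshold-< m n k h with ℚᵘ.<-respʳ-≃ (ℚ.toℚᵘ-fromℚᵘ (mkℚᵘ (+ k) 0)) (ℚᵘ.<-respˡ-≃ (threshold-ᵘ m n) (ℚ.toℚᵘ-mono-< h))
  ... | ℚᵘ.*<* lt = ℤ.drop‿+<+ (subst₂ ℤ._<_ lhs rhs (ℤ.+-monoˡ-< (+ 7 ℤ.* + n) lt))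
    where
    q : ℕ
    q = suc (7 * m)
    collect : ∀ q n → ((+ 1 ℤ.* q ℤ.+ -[1+ 6 ] ℤ.* + 1) ℤ.* n) ℤ.* + 1 ℤ.+ + 7 ℤ.* n ≡ q ℤ.* n
    collect = solve-∀
    -- The shapes here and in `rhs` are those to which cross-multiplication computes; `-[1+ 6 ]` is
    -- -7.
    lhs : ((+ 1 ℤ.* + q ℤ.+ -[1+ 6 ] ℤ.* + 1) ℤ.* + n) ℤ.* + 1 ℤ.+ + 7 ℤ.* + n ≡ + (q * n)
    lhs = trans (collect (+ q) (+ n)) (sym (ℤ.pos-* q n))
    rhs : + k ℤ.* + ((q + 0) * 1) ℤ.+ + 7 ℤ.* + n ≡ + (q * k + 7 * n)
    rhs = cong₂ ℤ._+_
      (trans (sym (ℤ.pos-* k ((q + 0) * 1)))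
        (cong +_ (trans (cong (k *_) (trans (*-identityʳ (q + 0)) (+-identityʳ q))) (*-comm k q))))
      (sym (ℤ.pos-* 7 n))

-- Induction on b and on a

module Extremal {n : ℕ} (G : Graph n) (D : ℕ) (missing : ∀ v → ∣ full ∖ adj G v ∣ ≤ D) where

  open Colouring G
  open Dense G D missing
  open Peeling G D missing

  four-colour : ∀ {U} → Cond 3 U → LocallyCol 3 U → Col 4 U
  four-colour {U} cond loc =
    let A  , lrg  = largest-indep U
        A′ , lrg′ = largest-indep (U ∖ A)
    in go lrg lrg′
    where
    go : ∀ {A A′} → Largest U A → Largest (U ∖ A) A′ → Col 4 U
    go {A} {A′} lrg@(_ , indA , _) lrg′@(_ , indA′ , _) = add-class indA (add-class indA′
      (Bipartite.bipartite G D missing W′ (λ x∈ → ∖ˡ (∖ˡ x∈)) (cond-big 3 cond) rest col))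
      where
      W′ : VSet n
      W′ = (U ∖ A) ∖ A′
      rest : ∣ U ∖ W′ ∣ ≤ 2 * D
      rest = linear
        (∣ U ∖ W′ ∣ ∷ ∣ (U ∖ W′) ∩ A ∣ ∷ ∣ (U ∖ W′) ∖ A ∣ ∷ D ∷ [])
        (λ { (r ∷ a ∷ a′ ∷ d ∷ []) → (r ≼ a ⊞ a′) ∷ (a ≼ d) ∷ (a′ ≼ d) ∷ [] ⊢ r ≼ 2 ⊠ d })
        (≤-reflexive (card-split (U ∖ W′) A)
        , ≤-trans (card-mono ∩ʳ) (indep-card indA)
        , ≤-trans (card-mono in-A′) (indep-card indA′))
        where
        in-A′ : (U ∖ W′) ∖ A ⊆ A′
        in-A′ {x} x∈ with x ∈? A′
        ... | yes x∈A′ = x∈A′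
        ... | no  x∉A′ = ⊥-elim (∖ʳ (∖ˡ x∈) (∖⁺ (∖⁺ (∖ˡ (∖ˡ x∈)) (∖ʳ x∈)) x∉A′))
      col : ∀ {x} → x ∈ U → Col 2 (W′ ∩ N x)
      col {x} x∈U with x ∈? A
      -- A vertex of `A` still has three colours around it after the first peeling, so the second is
      -- needed; for the other vertices the first one suffices.
      ... | yes x∈A = peel-twice cond loc lrg lrg′ x∈A
      ... | no  x∉A = Col-⊆ (λ v∈ → ∩⁺ (∖ˡ (∩ˡ v∈)) (∩ʳ v∈))
                        (peel {b = 0} (cond-big 3 cond) loc lrg (∖⁺ x∈U x∉A))

  -- Removing `A` costs one colour and at most `D` vertices, which is just what lowering `b` by one
  -- takes off `Cond`.
  local-to-global : ∀ b {U} → Cond (3 + b) U → LocallyCol (3 + b) U → Col (4 + b) U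
  local-to-global zero    cond loc = four-colour cond loc
  local-to-global (suc b) {U} cond loc with largest-indep U
  ... | A , lrg@(_ , indA , _) = add-class indA
    (local-to-global b cond′ (peel {b = suc b} (cond-big (4 + b) cond) loc lrg))
    where
    cond′ : Cond (3 + b) (U ∖ A)
    cond′ = linear
      (D ∷ (3 + b) * D ∷ ∣ U ∣ ∷ ∣ U ∩ A ∣ ∷ ∣ U ∖ A ∣ ∷ [])
      (λ { (d ∷ bd ∷ u ∷ a ∷ w ∷ []) →
        (con 1 ⊞ (7 ⊠ (d ⊞ bd) ⊞ d) ≼ 7 ⊠ u) ∷ (7 · u ≼ a ⊞ w) ∷ (7 · a ≼ d) ∷ []
        ⊢ con 1 ⊞ (7 ⊠ bd ⊞ d) ≼ 7 ⊠ w })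
      (cond , ≤-reflexive (card-split U A) , ≤-trans (card-mono ∩ʳ) (indep-card indA))

  -- Local partiteness with the clique chosen one vertex at a time, in the form needed for recursion
  -- on its size.
  CliqueLocallyCol : ℕ → ℕ → VSet n → Set
  CliqueLocallyCol zero    b U = Col b U
  CliqueLocallyCol (suc a) b U = ∀ {v} → v ∈ U → CliqueLocallyCol a b (U ∩ N v)

  -- Passing to a neighbourhood lowers ℓ by one and keeps D.
  clique-local-to-global : ∀ a {b U} → 3 ≤ b → Cond (a + b) U → CliqueLocallyCol (suc a) b U → Col (suc (a + b)) U
  clique-local-to-global zero    (s≤s (s≤s (s≤s z≤n))) cond loc = local-to-global _ cond loc
  clique-local-to-global (suc a) {b} {U} 3≤b cond loc =
    finish (≤-trans 3≤b (m≤n+m b (suc a))) cond λ {v} v∈ →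
      clique-local-to-global a 3≤b (cond′ v) (loc v∈)
    where
    finish : ∀ {k} → 3 ≤ k → Cond k U → LocallyCol k U → Col (suc k) U
    finish (s≤s (s≤s (s≤s z≤n))) = local-to-global _
    cond′ : ∀ v → Cond (a + b) (U ∩ N v)
    cond′ v = linear (D ∷ (a + b) * D ∷ ∣ U ∣ ∷ ∣ U ∩ N v ∣ ∷ [])
      (λ { (d ∷ bd ∷ u ∷ s ∷ []) →
        (con 1 ⊞ (7 ⊠ (d ⊞ bd) ⊞ d) ≼ 7 ⊠ u) ∷ (7 · u ≼ s ⊞ d) ∷ [] ⊢ con 1 ⊞ (7 ⊠ bd ⊞ d) ≼ 7 ⊠ s })
      (cond , card-neighbours U v)

  -- `K` collects the vertices chosen so far, and `U` stays inside their common neighbourhood.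
  from-cliques : ∀ a {b k} (K : Fin k → Fin n) → IsClique G K → LocallyPartite (a + k) (suc b) G →
    ∀ {U} → (∀ {v} → v ∈ U → InCommonNbhd G K v) → CliqueLocallyCol a (suc b) U
  from-cliques zero {b} K clique loc {U} U⊆ = colour , proper
    where
    c = proj₁ (loc K clique)
    inCommon? : ∀ v → Dec (InCommonNbhd G K v)
    inCommon? v = all? λ i → adj G (K i) v Bool.≟ true
    colour : Fin n → Fin (suc b)
    colour v with inCommon? v
    ... | yes common = c v common
    -- Never met on `U`; having a colour to spare here is why the bound is written `suc b`.
    ... | no _       = zero
    proper : Proper U colour
    proper {u} {v} u∈ v∈ (mem uv) with inCommon? u | inCommon? v
    ... | yes p | yes q = proj₂ (loc K clique) u v p q uv
    ... | yes _ | no ¬q = ⊥-elim (¬q (U⊆ v∈))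
    ... | no ¬p | _     = ⊥-elim (¬p (U⊆ u∈))
  from-cliques (suc a) {b} {k} K clique loc {U} U⊆ {v} v∈U =
    from-cliques a K⁺ clique⁺ (subst (λ m → LocallyPartite m (suc b) G) (sym (+-suc a k)) loc) U⊆⁺
    where
    K⁺ : Fin (suc k) → Fin n
    K⁺ zero    = v
    K⁺ (suc i) = K i
    adjacent : ∀ {u w} → adj G u w ≡ true → u ≢ w × adj G u w ≡ true
    adjacent uw = (λ { refl → N-irrefl (mem uw) }) , uw
    clique⁺ : IsClique G K⁺
    clique⁺ zero    zero    i≢j = ⊥-elim (i≢j refl)
    clique⁺ zero    (suc j) _   = adjacent (trans (adj-sym G v (K j)) (U⊆ v∈U j))
    clique⁺ (suc i) zero    _   = adjacent (U⊆ v∈U i)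
    clique⁺ (suc i) (suc j) i≢j = clique i j (i≢j ∘ cong suc)
    U⊆⁺ : ∀ {w} → w ∈ U ∩ N v → InCommonNbhd G K⁺ w
    U⊆⁺ w∈ zero    = holds (∩ʳ w∈)
    U⊆⁺ w∈ (suc i) = U⊆ (∩ˡ w∈) i

-- From minimum degree to numbers of non-neighbours

bounded-max : ∀ {n} (f : Fin n → ℕ) q {m} → 0 < m → (∀ v → q * f v < m) → ∃ λ d → (∀ v → f v ≤ d) × q * d < m
bounded-max {zero}  f q {m} 0<m h = 0 , (λ ()) , subst (_< m) (sym (*-zeroʳ q)) 0<m
bounded-max {suc n} f q {m} 0<m h with bounded-max (f ∘ suc) q 0<m (h ∘ suc)
... | d , f≤d , qd<m = f zero ⊔ d
  , (λ { zero → m≤m⊔n (f zero) d ; (suc v) → ≤-trans (f≤d v) (m≤n⊔m (f zero) d) })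
  , subst (_< m) (sym (*-distribˡ-⊔ q (f zero) d)) (⊔-lub (h zero) qd<m)

-- As a graph has no loops, `v` is counted among its own non-neighbours.
degree-missing : ∀ {n} (G : Graph n) v → n ≡ deg G v + ∣ full ∖ adj G v ∣
degree-missing {n} G v = begin
  n                                                    ≡⟨ card-full ⟨
  ∣ full {n} ∣                                         ≡⟨ card-split full (adj G v) ⟩
  ∣ full ∩ adj G v ∣ + ∣ full ∖ adj G v ∣              ≡⟨ cong (_+ ∣ full ∖ adj G v ∣) (≤-antisym (card-mono ∩ʳ) (card-mono λ x∈ → ∩⁺ (mem refl) x∈)) ⟩
  ∣ adj G v ∣ + ∣ full ∖ adj G v ∣                     ≡⟨ cong (_+ ∣ full ∖ adj G v ∣) (card-def (adj G v)) ⟩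
  deg G v + ∣ full ∖ adj G v ∣                         ∎
  where open ≡-Reasoning

missing-< : ∀ m {n} (G : Graph n) → MinDegAbove G (threshold m) → ∀ v → suc (7 * m) * ∣ full ∖ adj G v ∣ < 7 * n
missing-< m {n} G above v = +-cancelˡ-≤ (suc (7 * m) * deg G v) _ _ (begin
  suc (7 * m) * deg G v + suc (suc (7 * m) * ∣ full ∖ adj G v ∣)   ≡⟨ +-suc _ _ ⟩
  suc (suc (7 * m) * deg G v + suc (7 * m) * ∣ full ∖ adj G v ∣)   ≡⟨ cong suc (*-distribˡ-+ (suc (7 * m)) (deg G v) _) ⟨
  suc (suc (7 * m) * (deg G v + ∣ full ∖ adj G v ∣))               ≡⟨ cong (λ t → suc (suc (7 * m) * t)) (degree-missing G v) ⟨
  suc (suc (7 * m) * n)                                            ≤⟨ threshold-< m n (deg G v) (above v) ⟩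
  suc (7 * m) * deg G v + 7 * n                                    ∎)
  where open ≤-Reasoning

colour-by-missing : ∀ a {b n} (G : Graph n) → 3 ≤ b → LocallyPartite (suc a) b G →
  (∀ v → suc (7 * (a + b)) * ∣ full ∖ adj G v ∣ < 7 * n) → Colourable G (suc (a + b))
colour-by-missing a {b} {zero} G 3≤b loc h = (λ ()) , λ ()
-- `D` is the largest number of non-neighbours, so the strict inequality survives. The empty graph
-- is separate because `bounded-max` needs a positive bound.
colour-by-missing a {suc b} {suc n} G 3≤b loc h with bounded-max (λ v → ∣ full ∖ adj G v ∣) (suc (7 * (a + suc b))) (s≤s z≤n) h
... | D , missing , D< = colour (clique-local-to-global a 3≤b cond
    (from-cliques (suc a) (λ ()) (λ ()) (subst (λ m → LocallyPartite m (suc b) G) (sym (+-identityʳ (suc a))) loc) λ _ ()))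
  where
  open Colouring G
  open Extremal G D missing
  open Peeling G D missing using (Cond)
  cond : Cond (a + suc b) full
  cond = subst₂ _<_
    (trans (+-comm D _) (cong (_+ D) (*-assoc 7 (a + suc b) D)))
    (cong (7 *_) (sym card-full)) D<
  colour : ∀ {k} → Col k full → Colourable G k
  colour (c , proper) = c , λ u v uv → proper (mem refl) (mem refl) (mem uv)

colourable : ∀ a {b n} (G : Graph n) → 3 ≤ b → LocallyPartite (suc a) b G → MinDegAbove G (threshold (a + b)) →
  Colourable G (suc (a + b))
colourable a {b} G 3≤b loc above = colour-by-missing a G 3≤b loc (missing-< (a + b) G above)

above-from-atLeast : ∀ {t d n} {G : Graph n} → t ℚ.< d → MinDegAtLeast G d → MinDegAbove G t
above-from-atLeast {n = suc n} t<d atLeast v = ℚ.<-≤-trans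
  (ℚ.*-monoˡ-<-pos (toℚ (suc n)) {{ℚ.positive {toℚ (suc n)} toℚ-positive}} t<d) (atLeast v)
  where
  toℚ-positive : ℚ.0ℚ ℚ.< toℚ (suc n)
  toℚ-positive = ℚ.toℚᵘ-cancel-< (ℚᵘ.<-respʳ-≃ (ℚᵘ.≃-sym (ℚ.toℚᵘ-fromℚᵘ (mkℚᵘ (ℤ.+ suc n) 0)))
    (ℚᵘ.*<* (ℤ.+<+ (s≤s z≤n))))

theorem1p3 : ∀ (a b : ℕ) → 1 ≤ a → 3 ≤ b →
    δχ≤ (LocallyPartite a b) (suc (a + b ∸ 1)) (threshold (a + b ∸ 1))
    × (∀ n (G : Graph n) → LocallyPartite 1 b G →
    MinDegAbove G (threshold b) → Colourable G (suc b))
theorem1p3 (suc a) b _ 3≤b =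
    -- With the clique size written `suc a`, the number ℓ computes to `a + b`; the second claim is
    -- the case ℓ = b.
    (λ d t<d n G loc atLeast → colourable a G 3≤b loc (above-from-atLeast {G = G} t<d atLeast))
  , (λ n G loc above → colourable 0 G 3≤b loc above)
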